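{- Let $k,\ell$ be positive integers and let $n > 108 k^2 \ell (k+\ell)$. For every integer $s$ with $0 \le s \le \binom{n}{k} - \binom{n-\ell}{k}$, the family $\mathcal{L}_{n,k}(s)$ minimizes the number of disjoint pairs among all families of $s$ sets in $\binom{[n]}{k}$; that is, $\mathrm{disj}(\mathcal{F}) \ge \mathrm{disj}(\mathcal{L}_{n,k}(s))$ for every $\mathcal{F} \subseteq \binom{[n]}{k}$ with $|\mathcal{F}| = s$.
   Context: $[n]=\{1,\dots,n\}$ and $\binom{[n]}{k}$ is the set of all $k$-element subsets of $[n]$. The lexicographical ordering on $\binom{[n]}{k}$ is defined by $A < B$ if $\min(A \,\Delta\, B) \in A$. $\mathcal{L}_{n,k}(s)$ denotes the family of the first $s$ sets of $\binom{[n]}{k}$ in the lexicographical ordering. For a family $\mathcal{F}$, $\mathrm{disj}(\mathcal{F})$ is the number of unordered pairs $\{F_1,F_2\}$ of members of $\mathcal{F}$ with $F_1 \cap F_2 = \emptyset$. -}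

module Defs where

open import Data.Bool using (Bool; true; false; not; _∧_)
open import Data.Nat using (ℕ; zero; suc; _+_)
open import Data.List using (List; []; _∷_; _++_; map; length; filter)
open import Data.Vec using (Vec; []; _∷_; replicate)
open import Data.Fin.Subset using (Subset; inside; outside)
open import Relation.Nullary.Decidable using (Dec)
open import Data.Bool using (T; T?)

-- Subsets of [n] = {1,…,n} are 'Subset n' (Vec Bool n); position i (0-based)
-- represents the element i+1.

-- All k-element subsets of [n], listed in lexicographic order:
-- A < B iff min(A Δ B) ∈ A, i.e. at the first position where they differ,
-- A has 'inside' (true) and B has 'outside' (false).
kSubsets : (n k : ℕ) → List (Subset n)
kSubsets zero zero = [] ∷ []
kSubsets zero (suc k) = []
kSubsets (suc n) zero = map (outside ∷_) (kSubsets n zero)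
kSubsets (suc n) (suc k) =
  map (inside ∷_) (kSubsets n k) ++ map (outside ∷_) (kSubsets n (suc k))

L : (n k s : ℕ) → List (Subset n)
L n k s = Data.List.take s (kSubsets n k)

disjointᵇ : ∀ {n} → Subset n → Subset n → Bool
disjointᵇ [] [] = true
disjointᵇ (x ∷ xs) (y ∷ ys) = not (x ∧ y) ∧ disjointᵇ xs ys

disj : ∀ {n} → List (Subset n) → ℕ
disj [] = 0
disj (A ∷ F) = length (filter (λ B → T? (disjointᵇ A B)) F) + disj F

{-# OPTIONS --safe #-}
-- Disjoint pairs are counted through D(F,G), the number of (A,B) ∈ F × G with A ∩ B = ∅, so that
-- 2 disj(F) = D(F,F).  Write d for the largest degree of a point in F, s = |F|, and q for the
-- number of k-sets through two given points.
--
-- Induct on ℓ, and for fixed ℓ on disj(F); one may assume s exceeds the size of ℓ - 1 full stars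
-- (and ℓ ≥ 2).  If F contains a full star, delete its centre.  Otherwise, if some A ∈ F meets
-- fewer than d members of F, exchanging A for a missing set of the largest star lowers disj(F).
-- So every A ∈ F meets at least d members, and it suffices to find ℓ points that cover F: a family
-- covered by ℓ points is compared with the lexicographic one through the complements, since every
-- k-set is disjoint from the same number of k-sets.
--
-- If F has at most as many disjoint pairs as the lexicographic family, at least s²/ℓ ordered pairs
-- meet, and a second moment estimate gives d ≥ s/ℓ - k²ℓq.  Counting the meeting pairs (A,B) with
-- x ∈ A in two ways gives d · deg x ≤ (deg x)² + skq, so that every degree is either tiny or nearly
-- d.  The points of degree nearly d cover F, and as their degrees add up to about s there are at
-- most ℓ of them.
module Submission where

open import Defs
open import Data.Bool using (Bool; true; false; not; _∧_; if_then_else_; T; T?)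
open import Data.Bool.Properties using (∧-comm)
open import Data.Fin using (Fin; zero; suc)
open import Data.Fin.Subset using (Subset; ∣_∣; inside; outside; ⁅_⁆; _∪_; ⊥)
open import Data.Fin.Subset.Properties using (∣p∣≤n; ∣⁅x⁆∣≡1)
open import Data.List using (List; []; _∷_; _++_; map; length; filter; take; drop; allFin)
open import Data.List.Extrema.Nat using (argmax; f[xs]≤f[argmax])
open import Data.List.Membership.Propositional using (_∈_; _∉_; find)
open import Data.List.Membership.Propositional.Properties
  using (∈-∃++; ∈-++⁻; ∈-++⁺ˡ; ∈-++⁺ʳ; ∈-map⁺; ∈-map⁻; ∈-filter⁻; ∈-allFin)
open import Data.List.Properties
  using (map-++; map-∘; map-tabulate; length-++; length-map; length-take; length-drop;
         take-map; drop-map; take++drop≡id)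
open import Data.List.Relation.Binary.Permutation.Propositional
  using (_↭_; ↭-refl; ↭-sym; ↭-trans; ↭-reflexive; ↭⇒↭ₛ)
open import Data.List.Relation.Binary.Permutation.Propositional.Properties
  using (shift; map⁺; ++⁺ˡ; ∈-resp-↭; ↭-length)
import Data.List.Relation.Binary.Permutation.Setoid.Properties as Permutationₛ
open import Data.List.Relation.Unary.All as All using (All; []; _∷_)
open import Data.List.Relation.Unary.All.Properties using (all-filter; take⁺; ¬All⇒Any¬)
open import Data.List.Relation.Unary.AllPairs using ([]; _∷_)
open import Data.List.Relation.Unary.Any using (here; there)
open import Data.List.Relation.Unary.Unique.Propositional using (Unique)
import Data.List.Relation.Unary.Unique.Propositional.Properties as Unique
open import Data.Nat
  using (ℕ; zero; suc; _+_; _*_; _∸_; _≤_; _<_; z≤n; s≤s; _≤?_; NonZero; >-nonZero;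
         _≤′_; ≤′-refl; ≤′-step)
open import Data.Nat.Combinatorics using (_C_; nC1≡n; k>n⇒nCk≡0; nCk+nC[k+1]≡[n+1]C[k+1])
open import Data.Nat.Induction using (<-wellFounded)
open import Data.Nat.ListAction using (sum)
open import Data.Nat.ListAction.Properties using (sum-++; sum-↭)
open import Data.Nat.Properties
open import Data.Nat.Tactic.RingSolver using (solve-∀)
open import Data.Product using (∃; _×_; _,_; proj₁; proj₂)
open import Data.Sum using (inj₁; inj₂)
open import Data.Vec using ([]; _∷_; lookup; removeAt; insertAt; tabulate)
open import Data.Vec.Properties using (∷-injectiveʳ; insertAt-removeAt; lookup∘tabulate)
open import Function using (_∘_; id)
open import Induction.WellFounded using (Acc; acc)
open import Relation.Binary.PropositionalEquality
  using (_≡_; _≢_; refl; sym; trans; cong; cong₂; subst; setoid; module ≡-Reasoning)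
open import Relation.Nullary using (¬_; Dec; yes; no; does; contradiction)
open import Relation.Unary using (Decidable)

-- The bound on d named in the overview does not finish the proof. Measured in `a = r * r * k * q`,
-- with r in the role of ℓ, it reads s ≤ rd + ka. Excluding r + 1 points of degree nearly d from
-- this alone would require s to exceed a constant times rka, hence a product kℓ where the
-- hypothesis on n has the sum k + ℓ. The rough bound therefore serves only to obtain 4s ≤ 5rd. That
-- already shows that the heavy points form a cover and that there are fewer than 2r of them.
-- Counting meeting pairs through the points of this cover then gives s ≤ rd + 10a, whose loss
-- carries no extra factor k, and now r + 1 heavy points are impossible.
--
-- The constant 108 is 2 * 54. The inequality 54(k + r)a ≤ s absorbs all error terms, and the factor
-- 2 pays for s ≥ ℓN/2, where N is the size of a star: ℓ - 1 stars overlap, but each one after the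
-- first still adds at least N/2 new sets. This is why s is first made larger than ℓ - 1 full stars.

private variable
  n k : ℕ
  A B : Set

-- Finite sums over lists

-- The first premise is l - r ≤ L - R, written without subtraction.
linear : ∀ {l r L R : ℕ} → l + R ≤ r + L → L ≤ R → l ≤ r
linear {l} {r} {L} {R} eq L≤R = +-cancelʳ-≤ R l r (≤-trans eq (+-monoʳ-≤ r L≤R))

⟦_⟧ : Bool → ℕ
⟦ b ⟧ = if b then 1 else 0

⟦not⟧ : ∀ b → ⟦ not b ⟧ + ⟦ b ⟧ ≡ 1
⟦not⟧ true  = refl
⟦not⟧ false = refl

⟦∧⟧ : ∀ b c → ⟦ b ∧ c ⟧ ≡ ⟦ b ⟧ * ⟦ c ⟧
⟦∧⟧ true  c = sym (*-identityˡ ⟦ c ⟧)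
⟦∧⟧ false c = refl

⟦⟧≤1 : ∀ b → ⟦ b ⟧ ≤ 1
⟦⟧≤1 true  = ≤-refl
⟦⟧≤1 false = z≤n

∑ : List A → (A → ℕ) → ℕ
∑ xs f = sum (map f xs)

infix 5 ∑
syntax ∑ xs (λ x → e) = ∑[ x ∈ xs ] e

∑-++ : ∀ (xs ys : List A) (f : A → ℕ) → ∑ (xs ++ ys) f ≡ ∑ xs f + ∑ ys f
∑-++ xs ys f = trans (cong sum (map-++ f xs ys)) (sum-++ (map f xs) (map f ys))

∑-map : ∀ (g : A → B) (xs : List A) (f : B → ℕ) → ∑ (map g xs) f ≡ ∑ xs (f ∘ g)
∑-map g xs f = cong sum (sym (map-∘ xs))

∑-↭ : ∀ {xs ys : List A} (f : A → ℕ) → xs ↭ ys → ∑ xs f ≡ ∑ ys f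
∑-↭ f p = sum-↭ (map⁺ f p)

∑-cong : ∀ (xs : List A) {f g : A → ℕ} → (∀ {x} → x ∈ xs → f x ≡ g x) → ∑ xs f ≡ ∑ xs g
∑-cong []       h = refl
∑-cong (x ∷ xs) h = cong₂ _+_ (h (here refl)) (∑-cong xs (h ∘ there))

∑-mono : ∀ (xs : List A) {f g : A → ℕ} → (∀ {x} → x ∈ xs → f x ≤ g x) → ∑ xs f ≤ ∑ xs g
∑-mono []       h = z≤n
∑-mono (x ∷ xs) h = +-mono-≤ (h (here refl)) (∑-mono xs (h ∘ there))

∑-+ : ∀ (xs : List A) (f g : A → ℕ) → (∑[ x ∈ xs ] f x + g x) ≡ ∑ xs f + ∑ xs g
∑-+ []       f g = refl
∑-+ (x ∷ xs) f g rewrite ∑-+ xs f g = lemma (f x) (g x) (∑ xs f) (∑ xs g)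
  where
  lemma : ∀ a b c d → a + b + (c + d) ≡ a + c + (b + d)
  lemma = solve-∀

∑-*ˡ : ∀ (xs : List A) c (f : A → ℕ) → (∑[ x ∈ xs ] c * f x) ≡ c * ∑ xs f
∑-*ˡ []       c f = sym (*-zeroʳ c)
∑-*ˡ (x ∷ xs) c f rewrite ∑-*ˡ xs c f = sym (*-distribˡ-+ c (f x) (∑ xs f))

∑-*ʳ : ∀ (xs : List A) c (f : A → ℕ) → (∑[ x ∈ xs ] f x * c) ≡ ∑ xs f * c
∑-*ʳ []       c f = refl
∑-*ʳ (x ∷ xs) c f rewrite ∑-*ʳ xs c f = sym (*-distribʳ-+ c (f x) (∑ xs f))

∑-const : ∀ (xs : List A) c → (∑[ _ ∈ xs ] c) ≡ length xs * c
∑-const []       c = refl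
∑-const (x ∷ xs) c = cong (c +_) (∑-const xs c)

∑-swap : ∀ (xs : List A) (ys : List B) (f : A → B → ℕ) →
  (∑[ x ∈ xs ] ∑[ y ∈ ys ] f x y) ≡ (∑[ y ∈ ys ] ∑[ x ∈ xs ] f x y)
∑-swap []       ys f = sym (trans (∑-const ys 0) (*-zeroʳ (length ys)))
∑-swap (x ∷ xs) ys f =
  trans (cong (∑ ys (f x) +_) (∑-swap xs ys f)) (sym (∑-+ ys (f x) (λ y → ∑[ x ∈ xs ] f x y)))

∑-≥-const : ∀ (xs : List A) {f : A → ℕ} c → (∀ {x} → x ∈ xs → c ≤ f x) → length xs * c ≤ ∑ xs f
∑-≥-const xs c h = ≤-trans (≤-reflexive (sym (∑-const xs c))) (∑-mono xs h)

∑-∈ : ∀ {xs : List A} (f : A → ℕ) {x} → x ∈ xs → f x ≤ ∑ xs f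
∑-∈ f (here refl) = m≤m+n _ _
∑-∈ f (there x∈)  = ≤-trans (∑-∈ f x∈) (m≤n+m _ _)

∑-filter : ∀ {P : A → Set} (P? : Decidable P) (xs : List A) (f : A → ℕ) →
  ∑ (filter P? xs) f ≡ (∑[ x ∈ xs ] ⟦ does (P? x) ⟧ * f x)
∑-filter P? []       f = refl
∑-filter P? (x ∷ xs) f with does (P? x)
... | true  = cong₂ _+_ (sym (*-identityˡ (f x))) (∑-filter P? xs f)
... | false = ∑-filter P? xs f

length-∑ : ∀ (xs : List A) → length xs ≡ (∑[ _ ∈ xs ] 1)
length-∑ xs = sym (trans (∑-const xs 1) (*-identityʳ (length xs)))

∑-pos : ∀ (xs : List A) (f : A → ℕ) → 0 < ∑ xs f → ∃ λ x → x ∈ xs × 0 < f x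
∑-pos (x ∷ xs) f pos with f x in eq
... | suc m = x , here refl , subst (0 <_) (sym eq) (s≤s z≤n)
... | zero  with y , y∈ , q ← ∑-pos xs f pos = y , there y∈ , q

Unique-resp-↭ : {xs ys : List A} → xs ↭ ys → Unique xs → Unique ys
Unique-resp-↭ p = Permutationₛ.Unique-resp-↭ (setoid _) (↭⇒↭ₛ p)

∈⇒↭∷ : ∀ {x : A} {xs} → x ∈ xs → ∃ λ ys → xs ↭ x ∷ ys
∈⇒↭∷ {x = x} x∈ with ys , zs , refl ← ∈-∃++ x∈ = ys ++ zs , shift x ys zs

-- Applied to a family `F` inside the list of all k-sets, this produces the list `W` of missing
-- sets. A count over all k-sets then splits into a sum over `F` and a sum over `W`.
complement : ∀ {xs ys : List A} → Unique xs → (∀ {x} → x ∈ xs → x ∈ ys) → ∃ λ zs → ys ↭ xs ++ zs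
complement {xs = []}     {ys} []        xs⊆ = ys , ↭-refl
complement {xs = x ∷ xs} {ys} (x∉ ∷ u) xs⊆
  with zs , ys↭ ← complement u (xs⊆ ∘ there)
  with ∈-++⁻ xs (∈-resp-↭ ys↭ (xs⊆ (here refl)))
... | inj₁ x∈xs = contradiction x∈xs (Unique.Unique[x∷xs]⇒x∉xs (x∉ ∷ u))
... | inj₂ x∈zs with ws , zs↭ ← ∈⇒↭∷ x∈zs =
  ws , ↭-trans ys↭ (↭-trans (++⁺ˡ xs zs↭) (shift x xs ws))

-- Binomial coefficients and counting k-sets

pascal : ∀ n k → suc n C suc k ≡ n C k + n C suc k
pascal n k = sym (nCk+nC[k+1]≡[n+1]C[k+1] n k)

C-monoˡ : ∀ k {m n} → m ≤ n → m C k ≤ n C k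
C-monoˡ k m≤n = go (≤⇒≤′ m≤n)
  where
  step : ∀ n k → n C k ≤ suc n C k
  step n zero    = ≤-refl
  step n (suc k) = ≤-trans (m≤n+m _ _) (≤-reflexive (sym (pascal n k)))
  go : ∀ {m n} → m ≤′ n → m C k ≤ n C k
  go ≤′-refl     = ≤-refl
  go (≤′-step p) = ≤-trans (go p) (step _ k)

absorption : ∀ n k → suc k * (suc n C suc k) ≡ suc n * (n C k)
absorption zero    zero    = refl
absorption zero    (suc k) =
  trans (cong (suc (suc k) *_) (k>n⇒nCk≡0 {1} {suc (suc k)} (s≤s (s≤s z≤n)))) (*-zeroʳ (suc (suc k)))
absorption (suc n) zero    = trans (*-identityˡ _) (trans (nC1≡n (suc (suc n))) (sym (*-identityʳ _)))
absorption (suc n) (suc k) = begin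
  suc (suc k) * (suc (suc n) C suc (suc k))
    ≡⟨ cong (suc (suc k) *_) (pascal (suc n) (suc k)) ⟩
  suc (suc k) * (suc n C suc k + suc n C suc (suc k))
    ≡⟨ lemma (suc k) (suc n C suc k) (suc n C suc (suc k)) ⟩
  suc n C suc k + (suc k * (suc n C suc k) + suc (suc k) * (suc n C suc (suc k)))
    ≡⟨ cong₂ (λ a b → suc n C suc k + (a + b)) (absorption n k) (absorption n (suc k)) ⟩
  suc n C suc k + (suc n * (n C k) + suc n * (n C suc k))
    ≡⟨ cong (suc n C suc k +_) (sym (*-distribˡ-+ (suc n) (n C k) (n C suc k))) ⟩
  suc n C suc k + suc n * (n C k + n C suc k)
    ≡⟨ cong (λ a → suc n C suc k + suc n * a) (sym (pascal n k)) ⟩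
  suc (suc n) * (suc n C suc k) ∎
  where
  open ≡-Reasoning
  lemma : ∀ k a b → suc k * (a + b) ≡ a + (k * a + suc k * b)
  lemma = solve-∀

-- Membership, disjointness and unions of sets

mem : Fin n → Subset n → ℕ
mem x A = ⟦ lookup A x ⟧

δ : Subset n → Subset n → ℕ
δ A B = ⟦ disjointᵇ A B ⟧

ι : Subset n → Subset n → ℕ
ι A B = ⟦ not (disjointᵇ A B) ⟧

ι+δ : ∀ (A B : Subset n) → ι A B + δ A B ≡ 1
ι+δ A B = ⟦not⟧ (disjointᵇ A B)

disjointᵇ-sym : ∀ (A B : Subset n) → disjointᵇ A B ≡ disjointᵇ B A
disjointᵇ-sym []      []      = refl
disjointᵇ-sym (a ∷ A) (b ∷ B) = cong₂ (λ c d → not c ∧ d) (∧-comm a b) (disjointᵇ-sym A B)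

δ-sym : ∀ (A B : Subset n) → δ A B ≡ δ B A
δ-sym A B = cong ⟦_⟧ (disjointᵇ-sym A B)

δ-self : ∀ (A : Subset n) → 0 < ∣ A ∣ → δ A A ≡ 0
δ-self (inside  ∷ A) _  = refl
δ-self (outside ∷ A) 0< = δ-self A 0<

allFin-suc : ∀ n → allFin (suc n) ≡ zero ∷ map suc (allFin n)
allFin-suc n = cong (zero ∷_) (sym (map-tabulate id suc))

∑-allFin-suc : ∀ n (f : Fin (suc n) → ℕ) → ∑ (allFin (suc n)) f ≡ f zero + ∑ (allFin n) (f ∘ suc)
∑-allFin-suc n f =
  trans (cong (λ xs → ∑ xs f) (allFin-suc n)) (cong (f zero +_) (∑-map suc (allFin n) f))

∣∣≡∑mem : ∀ (A : Subset n) → ∣ A ∣ ≡ (∑[ x ∈ allFin n ] mem x A)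
∣∣≡∑mem []            = refl
∣∣≡∑mem (inside  ∷ A) = trans (cong suc (∣∣≡∑mem A)) (sym (∑-allFin-suc _ λ x → mem x (inside ∷ A)))
∣∣≡∑mem (outside ∷ A) = trans (∣∣≡∑mem A) (sym (∑-allFin-suc _ λ x → mem x (outside ∷ A)))

ι≤∑mem : ∀ (A B : Subset n) → ι A B ≤ (∑[ x ∈ allFin n ] mem x A * mem x B)
ι≤∑mem []      []      = z≤n
ι≤∑mem (a ∷ A) (b ∷ B) = ≤-trans (head a b) (≤-reflexive (sym (∑-allFin-suc _ λ x → mem x (a ∷ A) * mem x (b ∷ B))))
  where
  head : ∀ a b → ι (a ∷ A) (b ∷ B) ≤ ⟦ a ⟧ * ⟦ b ⟧ + (∑[ x ∈ allFin _ ] mem x A * mem x B)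
  head true  true  = s≤s z≤n
  head true  false = ι≤∑mem A B
  head false _     = ι≤∑mem A B

mem*mem≤ι : ∀ (x : Fin n) (A B : Subset n) → mem x A * mem x B ≤ ι A B
mem*mem≤ι zero    (true  ∷ A) (true  ∷ B) = ≤-refl
mem*mem≤ι zero    (true  ∷ A) (false ∷ B) = z≤n
mem*mem≤ι zero    (false ∷ A) (b     ∷ B) = z≤n
mem*mem≤ι (suc x) (true  ∷ A) (true  ∷ B) = ≤-trans (mem*mem≤ι x A B) (⟦⟧≤1 (not (disjointᵇ A B)))
mem*mem≤ι (suc x) (true  ∷ A) (false ∷ B) = mem*mem≤ι x A B
mem*mem≤ι (suc x) (false ∷ A) (b     ∷ B) = mem*mem≤ι x A B

disjointᵇ-∪ : ∀ (X Y A : Subset n) → disjointᵇ (X ∪ Y) A ≡ disjointᵇ X A ∧ disjointᵇ Y A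
disjointᵇ-∪ []          []          []          = refl
disjointᵇ-∪ (true  ∷ X) (y     ∷ Y) (true  ∷ A) = refl
disjointᵇ-∪ (true  ∷ X) (true  ∷ Y) (false ∷ A) = disjointᵇ-∪ X Y A
disjointᵇ-∪ (true  ∷ X) (false ∷ Y) (false ∷ A) = disjointᵇ-∪ X Y A
disjointᵇ-∪ (false ∷ X) (true  ∷ Y) (true  ∷ A) = sym (∧-comm (disjointᵇ X A) false)
disjointᵇ-∪ (false ∷ X) (true  ∷ Y) (false ∷ A) = disjointᵇ-∪ X Y A
disjointᵇ-∪ (false ∷ X) (false ∷ Y) (a     ∷ A) = disjointᵇ-∪ X Y A

δ-∪ : ∀ (X Y A : Subset n) → δ (X ∪ Y) A ≡ δ X A * δ Y A
δ-∪ X Y A = trans (cong ⟦_⟧ (disjointᵇ-∪ X Y A)) (⟦∧⟧ (disjointᵇ X A) (disjointᵇ Y A))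

∣∪∣-disjoint : ∀ (X Y : Subset n) → disjointᵇ X Y ≡ true → ∣ X ∪ Y ∣ ≡ ∣ X ∣ + ∣ Y ∣
∣∪∣-disjoint []          []          _ = refl
∣∪∣-disjoint (true  ∷ X) (false ∷ Y) h = cong suc (∣∪∣-disjoint X Y h)
∣∪∣-disjoint (false ∷ X) (true  ∷ Y) h = trans (cong suc (∣∪∣-disjoint X Y h)) (sym (+-suc ∣ X ∣ ∣ Y ∣))
∣∪∣-disjoint (false ∷ X) (false ∷ Y) h = ∣∪∣-disjoint X Y h

∣∪∣-≤ : ∀ (X Y : Subset n) → ∣ X ∪ Y ∣ ≤ ∣ X ∣ + ∣ Y ∣
∣∪∣-≤ []          []          = z≤n
∣∪∣-≤ (true  ∷ X) (true  ∷ Y) = s≤s (≤-trans (∣∪∣-≤ X Y) (+-monoʳ-≤ ∣ X ∣ (n≤1+n ∣ Y ∣)))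
∣∪∣-≤ (true  ∷ X) (false ∷ Y) = s≤s (∣∪∣-≤ X Y)
∣∪∣-≤ (false ∷ X) (true  ∷ Y) = ≤-trans (s≤s (∣∪∣-≤ X Y)) (≤-reflexive (sym (+-suc ∣ X ∣ ∣ Y ∣)))
∣∪∣-≤ (false ∷ X) (false ∷ Y) = ∣∪∣-≤ X Y

∣∪∣-meeting : ∀ (X Y : Subset n) → disjointᵇ X Y ≡ false → ∣ X ∪ Y ∣ < ∣ X ∣ + ∣ Y ∣
∣∪∣-meeting []          []          ()
∣∪∣-meeting (true  ∷ X) (true  ∷ Y) h =
  s≤s (≤-trans (s≤s (∣∪∣-≤ X Y)) (≤-reflexive (sym (+-suc ∣ X ∣ ∣ Y ∣))))
∣∪∣-meeting (true  ∷ X) (false ∷ Y) h = s≤s (∣∪∣-meeting X Y h)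
∣∪∣-meeting (false ∷ X) (true  ∷ Y) h =
  ≤-trans (s≤s (∣∪∣-meeting X Y h)) (≤-reflexive (sym (+-suc ∣ X ∣ ∣ Y ∣)))
∣∪∣-meeting (false ∷ X) (false ∷ Y) h = ∣∪∣-meeting X Y h

disjointᵇ-⊥ : ∀ (A : Subset n) → disjointᵇ ⊥ A ≡ true
disjointᵇ-⊥ []      = refl
disjointᵇ-⊥ (a ∷ A) = disjointᵇ-⊥ A

disjointᵇ-⁅⁆ : ∀ (x : Fin n) A → disjointᵇ ⁅ x ⁆ A ≡ not (lookup A x)
disjointᵇ-⁅⁆ zero    (true  ∷ A) = refl
disjointᵇ-⁅⁆ zero    (false ∷ A) = disjointᵇ-⊥ A
disjointᵇ-⁅⁆ (suc x) (a     ∷ A) = disjointᵇ-⁅⁆ x A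

lookup-⊥ : ∀ (x : Fin n) → lookup ⊥ x ≡ false
lookup-⊥ zero    = refl
lookup-⊥ (suc x) = lookup-⊥ x

lookup-⁅⁆-≢ : ∀ {x y : Fin n} → x ≢ y → lookup ⁅ x ⁆ y ≡ false
lookup-⁅⁆-≢ {x = zero}  {zero}  x≢y = contradiction refl x≢y
lookup-⁅⁆-≢ {x = zero}  {suc y} x≢y = lookup-⊥ y
lookup-⁅⁆-≢ {x = suc x} {zero}  x≢y = refl
lookup-⁅⁆-≢ {x = suc x} {suc y} x≢y = lookup-⁅⁆-≢ (x≢y ∘ cong suc)

δ-⁅⁆ : ∀ (x : Fin n) A → mem x A + δ ⁅ x ⁆ A ≡ 1
δ-⁅⁆ x A rewrite disjointᵇ-⁅⁆ x A = trans (+-comm (mem x A) _) (⟦not⟧ (lookup A x))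

∣⁅x⁆∪⁅y⁆∣≡2 : ∀ {x y : Fin n} → x ≢ y → ∣ ⁅ x ⁆ ∪ ⁅ y ⁆ ∣ ≡ 2
∣⁅x⁆∪⁅y⁆∣≡2 {x = x} {y} x≢y =
  trans (∣∪∣-disjoint ⁅ x ⁆ ⁅ y ⁆ (trans (disjointᵇ-⁅⁆ x ⁅ y ⁆) (cong not (lookup-⁅⁆-≢ (x≢y ∘ sym)))))
        (cong₂ _+_ (∣⁅x⁆∣≡1 x) (∣⁅x⁆∣≡1 y))

-- The list of all k-sets and its counts

∈-kSubsets⁺ : ∀ k (A : Subset n) → ∣ A ∣ ≡ k → A ∈ kSubsets n k
∈-kSubsets⁺ zero    []          refl = here refl
∈-kSubsets⁺ zero    (false ∷ A) eq   = ∈-map⁺ (outside ∷_) (∈-kSubsets⁺ zero A eq)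
∈-kSubsets⁺ (suc k) (true  ∷ A) eq   = ∈-++⁺ˡ (∈-map⁺ (inside ∷_) (∈-kSubsets⁺ k A (suc-injective eq)))
∈-kSubsets⁺ (suc k) (false ∷ A) eq   =
  ∈-++⁺ʳ (map (inside ∷_) (kSubsets _ k)) (∈-map⁺ (outside ∷_) (∈-kSubsets⁺ (suc k) A eq))

∈-kSubsets⁻ : ∀ n k {A : Subset n} → A ∈ kSubsets n k → ∣ A ∣ ≡ k
∈-kSubsets⁻ zero    zero    (here refl) = refl
∈-kSubsets⁻ (suc n) zero    A∈ with _ , B∈ , refl ← ∈-map⁻ (outside ∷_) A∈ = ∈-kSubsets⁻ n zero B∈
∈-kSubsets⁻ (suc n) (suc k) A∈ with ∈-++⁻ (map (inside ∷_) (kSubsets n k)) A∈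
... | inj₁ A∈ˡ with _ , B∈ , refl ← ∈-map⁻ (inside ∷_) A∈ˡ  = cong suc (∈-kSubsets⁻ n k B∈)
... | inj₂ A∈ʳ with _ , B∈ , refl ← ∈-map⁻ (outside ∷_) A∈ʳ = ∈-kSubsets⁻ n (suc k) B∈

kSubsets-unique : ∀ n k → Unique (kSubsets n k)
kSubsets-unique zero    zero    = [] ∷ []
kSubsets-unique zero    (suc k) = []
kSubsets-unique (suc n) zero    = Unique.map⁺ ∷-injectiveʳ (kSubsets-unique n zero)
kSubsets-unique (suc n) (suc k) = Unique.++⁺
  (Unique.map⁺ ∷-injectiveʳ (kSubsets-unique n k))
  (Unique.map⁺ ∷-injectiveʳ (kSubsets-unique n (suc k)))
  λ (A∈ˡ , A∈ʳ) → contradiction (∈-map⁻ (outside ∷_) A∈ʳ) (apart (∈-map⁻ (inside ∷_) A∈ˡ))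
  where
  apart : ∀ {A} → (∃ λ B → B ∈ kSubsets n k × A ≡ inside ∷ B) →
          ¬ (∃ λ B → B ∈ kSubsets n (suc k) × A ≡ outside ∷ B)
  apart (_ , _ , refl) (_ , _ , ())

length-kSubsets : ∀ n k → length (kSubsets n k) ≡ n C k
length-kSubsets zero    zero    = refl
length-kSubsets zero    (suc k) = sym (k>n⇒nCk≡0 {0} {suc k} (s≤s z≤n))
length-kSubsets (suc n) zero    = trans (length-map _ (kSubsets n zero)) (length-kSubsets n zero)
length-kSubsets (suc n) (suc k) = begin
  length (map (inside ∷_) (kSubsets n k) ++ map (outside ∷_) (kSubsets n (suc k)))
    ≡⟨ length-++ (map (inside ∷_) (kSubsets n k)) ⟩
  length (map (inside ∷_) (kSubsets n k)) + length (map (outside ∷_) (kSubsets n (suc k)))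
    ≡⟨ cong₂ _+_ (length-map _ (kSubsets n k)) (length-map _ (kSubsets n (suc k))) ⟩
  length (kSubsets n k) + length (kSubsets n (suc k))
    ≡⟨ cong₂ _+_ (length-kSubsets n k) (length-kSubsets n (suc k)) ⟩
  n C k + n C suc k
    ≡⟨ sym (pascal n k) ⟩
  suc n C suc k ∎
  where open ≡-Reasoning

-- The k-sets avoiding `Z` are the k-subsets of the remaining points. All later counts (stars,
-- pairs, sets disjoint from a given set, sets outside a cover) come from this one by choosing `Z`
-- and using Pascal's rule.
count-avoiding : ∀ n k (Z : Subset n) → (∑[ A ∈ kSubsets n k ] δ Z A) ≡ (n ∸ ∣ Z ∣) C k
count-avoiding zero    zero    []          = refl
count-avoiding zero    (suc k) []          = sym (k>n⇒nCk≡0 {0} {suc k} (s≤s z≤n))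
count-avoiding (suc n) zero    (true  ∷ Z) =
  trans (∑-map _ (kSubsets n zero) _) (count-avoiding n zero Z)
count-avoiding (suc n) zero    (false ∷ Z) =
  trans (∑-map _ (kSubsets n zero) _) (count-avoiding n zero Z)
count-avoiding (suc n) (suc k) (true  ∷ Z) = begin
  ∑ (map (inside ∷_) (kSubsets n k) ++ map (outside ∷_) (kSubsets n (suc k))) (δ (true ∷ Z))
    ≡⟨ ∑-++ (map (inside ∷_) (kSubsets n k)) _ _ ⟩
  ∑ (map (inside ∷_) (kSubsets n k)) (δ (true ∷ Z))
    + ∑ (map (outside ∷_) (kSubsets n (suc k))) (δ (true ∷ Z))
    ≡⟨ cong₂ _+_ (∑-map _ (kSubsets n k) _) (∑-map _ (kSubsets n (suc k)) _) ⟩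
  (∑[ _ ∈ kSubsets n k ] 0) + ∑ (kSubsets n (suc k)) (δ Z)
    ≡⟨ cong₂ _+_ (trans (∑-const (kSubsets n k) 0) (*-zeroʳ (length (kSubsets n k)))) (count-avoiding n (suc k) Z) ⟩
  (n ∸ ∣ Z ∣) C suc k ∎
  where open ≡-Reasoning
count-avoiding (suc n) (suc k) (false ∷ Z) = begin
  ∑ (map (inside ∷_) (kSubsets n k) ++ map (outside ∷_) (kSubsets n (suc k))) (δ (false ∷ Z))
    ≡⟨ ∑-++ (map (inside ∷_) (kSubsets n k)) _ _ ⟩
  ∑ (map (inside ∷_) (kSubsets n k)) (δ (false ∷ Z))
    + ∑ (map (outside ∷_) (kSubsets n (suc k))) (δ (false ∷ Z))
    ≡⟨ cong₂ _+_ (∑-map _ (kSubsets n k) _) (∑-map _ (kSubsets n (suc k)) _) ⟩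
  ∑ (kSubsets n k) (δ Z) + ∑ (kSubsets n (suc k)) (δ Z)
    ≡⟨ cong₂ _+_ (count-avoiding n k Z) (count-avoiding n (suc k) Z) ⟩
  (n ∸ ∣ Z ∣) C k + (n ∸ ∣ Z ∣) C suc k
    ≡⟨ sym (pascal (n ∸ ∣ Z ∣) k) ⟩
  suc (n ∸ ∣ Z ∣) C suc k
    ≡⟨ cong (_C suc k) (sym (+-∸-assoc 1 (∣p∣≤n Z))) ⟩
  (suc n ∸ ∣ Z ∣) C suc k ∎
  where open ≡-Reasoning

count-star : ∀ n k (x : Fin (suc n)) → (∑[ A ∈ kSubsets (suc n) (suc k) ] mem x A) ≡ n C k
count-star n k x = +-cancelʳ-≡ (n C suc k) _ _ (begin
  (∑[ A ∈ U ] mem x A) + n C suc k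
    ≡⟨ cong (λ m → (∑[ A ∈ U ] mem x A) + (suc n ∸ m) C suc k) (sym (∣⁅x⁆∣≡1 x)) ⟩
  (∑[ A ∈ U ] mem x A) + (suc n ∸ ∣ ⁅ x ⁆ ∣) C suc k
    ≡⟨ cong ((∑[ A ∈ U ] mem x A) +_) (sym (count-avoiding (suc n) (suc k) ⁅ x ⁆)) ⟩
  (∑[ A ∈ U ] mem x A) + (∑[ A ∈ U ] δ ⁅ x ⁆ A)
    ≡⟨ sym (∑-+ U _ _) ⟩
  (∑[ A ∈ U ] mem x A + δ ⁅ x ⁆ A)
    ≡⟨ ∑-cong U (λ {A} _ → δ-⁅⁆ x A) ⟩
  (∑[ A ∈ U ] 1)
    ≡⟨ sym (length-∑ U) ⟩
  length U
    ≡⟨ length-kSubsets (suc n) (suc k) ⟩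
  suc n C suc k
    ≡⟨ pascal n k ⟩
  n C k + n C suc k ∎)
  where
  open ≡-Reasoning
  U = kSubsets (suc n) (suc k)

-- Inclusion and exclusion over the sets that avoid x, avoid y, or avoid both. The count itself is
-- C(n, k - 1); adding `n C k` states it without a predecessor of k.
count-pair : ∀ n k {x y : Fin (suc (suc n))} → x ≢ y →
  (∑[ A ∈ kSubsets (suc (suc n)) (suc k) ] mem x A * mem y A) + n C k ≡ suc n C k
count-pair n k {x} {y} x≢y = +-cancelʳ-≡ (suc n C suc k + n C suc k) _ _ (begin
  P + n C k + (suc n C suc k + n C suc k)
    ≡⟨ cong (λ c → P + n C k + (c + n C suc k)) (pascal n k) ⟩
  P + n C k + (n C k + n C suc k + n C suc k)
    ≡⟨ lemma₁ P (n C k) (n C suc k) ⟩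
  (P + (n C k + n C suc k)) + (n C k + n C suc k)
    ≡⟨ cong (λ c → P + c + c) (sym (pascal n k)) ⟩
  (P + suc n C suc k) + suc n C suc k
    ≡⟨ cong₂ (λ a b → P + a + b) (sym (avoid₁ x)) (sym (avoid₁ y)) ⟩
  (P + ∑ U (δ ⁅ x ⁆)) + ∑ U (δ ⁅ y ⁆)
    ≡⟨ cong (_+ ∑ U (δ ⁅ y ⁆)) (sym (∑-+ U _ _)) ⟩
  (∑[ A ∈ U ] mem x A * mem y A + δ ⁅ x ⁆ A) + ∑ U (δ ⁅ y ⁆)
    ≡⟨ sym (∑-+ U _ _) ⟩
  (∑[ A ∈ U ] mem x A * mem y A + δ ⁅ x ⁆ A + δ ⁅ y ⁆ A)
    ≡⟨ ∑-cong U (λ {A} _ → pointwise A) ⟩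
  (∑[ A ∈ U ] 1 + δ (⁅ x ⁆ ∪ ⁅ y ⁆) A)
    ≡⟨ ∑-+ U _ _ ⟩
  (∑[ A ∈ U ] 1) + (∑[ A ∈ U ] δ (⁅ x ⁆ ∪ ⁅ y ⁆) A)
    ≡⟨ cong₂ _+_ (trans (sym (length-∑ U)) (length-kSubsets (suc (suc n)) (suc k))) avoid₂ ⟩
  suc (suc n) C suc k + n C suc k
    ≡⟨ cong (_+ n C suc k) (pascal (suc n) k) ⟩
  suc n C k + suc n C suc k + n C suc k
    ≡⟨ +-assoc (suc n C k) _ _ ⟩
  suc n C k + (suc n C suc k + n C suc k) ∎)
  where
  open ≡-Reasoning
  U = kSubsets (suc (suc n)) (suc k)
  P = ∑[ A ∈ U ] mem x A * mem y A
  avoid₁ : ∀ z → ∑ U (δ ⁅ z ⁆) ≡ suc n C suc k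
  avoid₁ z = trans (count-avoiding (suc (suc n)) (suc k) ⁅ z ⁆) (cong (λ m → (suc (suc n) ∸ m) C suc k) (∣⁅x⁆∣≡1 z))
  avoid₂ : ∑ U (δ (⁅ x ⁆ ∪ ⁅ y ⁆)) ≡ n C suc k
  avoid₂ = trans (count-avoiding (suc (suc n)) (suc k) (⁅ x ⁆ ∪ ⁅ y ⁆))
                 (cong (λ m → (suc (suc n) ∸ m) C suc k) (∣⁅x⁆∪⁅y⁆∣≡2 x≢y))
  lemma₁ : ∀ p a b → p + a + (a + b + b) ≡ p + (a + b) + (a + b)
  lemma₁ = solve-∀
  lemma₂ : ∀ a b → ⟦ a ⟧ * ⟦ b ⟧ + ⟦ not a ⟧ + ⟦ not b ⟧ ≡ 1 + ⟦ not a ⟧ * ⟦ not b ⟧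
  lemma₂ true  true  = refl
  lemma₂ true  false = refl
  lemma₂ false true  = refl
  lemma₂ false false = refl
  pointwise : ∀ A → mem x A * mem y A + δ ⁅ x ⁆ A + δ ⁅ y ⁆ A ≡ 1 + δ (⁅ x ⁆ ∪ ⁅ y ⁆) A
  pointwise A
    rewrite δ-∪ ⁅ x ⁆ ⁅ y ⁆ A | disjointᵇ-⁅⁆ x A | disjointᵇ-⁅⁆ y A = lemma₂ (lookup A x) (lookup A y)

-- Degrees and codegrees

2ab≤a²+b² : ∀ a b → 2 * a * b ≤ a * a + b * b
2ab≤a²+b² a b with ≤-total a b
... | inj₁ a≤b = subst (λ b → 2 * a * b ≤ a * a + b * b) (m+[n∸m]≡n a≤b)
                   (≤-trans (m≤m+n _ (e * e)) (≤-reflexive (lemma a e)))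
  where
  e = b ∸ a
  lemma : ∀ a e → 2 * a * (a + e) + e * e ≡ a * a + (a + e) * (a + e)
  lemma = solve-∀
... | inj₂ b≤a = subst (λ a → 2 * a * b ≤ a * a + b * b) (m+[n∸m]≡n b≤a)
                   (≤-trans (m≤m+n _ (e * e)) (≤-reflexive (lemma b e)))
  where
  e = a ∸ b
  lemma : ∀ b e → 2 * (b + e) * b + e * e ≡ (b + e) * (b + e) + b * b
  lemma = solve-∀

mem-idem : ∀ (x : Fin n) A → mem x A * mem x A ≡ mem x A
mem-idem x A with lookup A x
... | true  = refl
... | false = refl

module Degrees {n} (F : List (Subset n)) where

  deg : Fin n → ℕ
  deg x = ∑[ A ∈ F ] mem x A

  codeg : Fin n → Fin n → ℕ
  codeg x y = ∑[ A ∈ F ] mem x A * mem y A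

  meet : Subset n → ℕ
  meet A = ∑[ B ∈ F ] ι A B

  s : ℕ
  s = length F

  ∑-mem-swap : ∀ (X : List (Fin n)) (w : Fin n → ℕ) (g : Subset n → ℕ) →
    (∑[ A ∈ F ] g A * (∑[ x ∈ X ] w x * mem x A)) ≡ (∑[ x ∈ X ] w x * (∑[ A ∈ F ] g A * mem x A))
  ∑-mem-swap X w g = begin
    (∑[ A ∈ F ] g A * (∑[ x ∈ X ] w x * mem x A))
      ≡⟨ ∑-cong F (λ {A} _ → sym (∑-*ˡ X (g A) _)) ⟩
    (∑[ A ∈ F ] ∑[ x ∈ X ] g A * (w x * mem x A))
      ≡⟨ ∑-swap F X _ ⟩
    (∑[ x ∈ X ] ∑[ A ∈ F ] g A * (w x * mem x A))
      ≡⟨ ∑-cong X (λ {x} _ → ∑-cong F (λ {A} _ → lemma (g A) (w x) (mem x A))) ⟩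
    (∑[ x ∈ X ] ∑[ A ∈ F ] w x * (g A * mem x A))
      ≡⟨ ∑-cong X (λ {x} _ → ∑-*ˡ F (w x) _) ⟩
    (∑[ x ∈ X ] w x * (∑[ A ∈ F ] g A * mem x A)) ∎
    where
    open ≡-Reasoning
    lemma : ∀ a b c → a * (b * c) ≡ b * (a * c)
    lemma = solve-∀

  ∑-weights : ∀ (X : List (Fin n)) (w : Fin n → ℕ) →
    (∑[ A ∈ F ] ∑[ x ∈ X ] w x * mem x A) ≡ (∑[ x ∈ X ] w x * deg x)
  ∑-weights X w = begin
    (∑[ A ∈ F ] ∑[ x ∈ X ] w x * mem x A)
      ≡⟨ ∑-cong F (λ _ → sym (*-identityˡ _)) ⟩
    (∑[ A ∈ F ] 1 * (∑[ x ∈ X ] w x * mem x A))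
      ≡⟨ ∑-mem-swap X w (λ _ → 1) ⟩
    (∑[ x ∈ X ] w x * (∑[ A ∈ F ] 1 * mem x A))
      ≡⟨ ∑-cong X (λ {x} _ → cong (w x *_) (∑-cong F (λ _ → *-identityˡ _))) ⟩
    (∑[ x ∈ X ] w x * deg x) ∎
    where open ≡-Reasoning

  meet≤∑deg : ∀ A → meet A ≤ (∑[ x ∈ allFin n ] deg x * mem x A)
  meet≤∑deg A = begin
    (∑[ B ∈ F ] ι A B)
      ≤⟨ ∑-mono F (λ {B} _ → ι≤∑mem A B) ⟩
    (∑[ B ∈ F ] ∑[ x ∈ allFin n ] mem x A * mem x B)
      ≡⟨ ∑-weights (allFin n) (λ x → mem x A) ⟩
    (∑[ x ∈ allFin n ] mem x A * deg x)
      ≡⟨ ∑-cong (allFin n) (λ {x} _ → *-comm (mem x A) (deg x)) ⟩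
    (∑[ x ∈ allFin n ] deg x * mem x A) ∎
    where open ≤-Reasoning

  module _ (k q : ℕ) (uniform : ∀ {A} → A ∈ F → ∣ A ∣ ≡ k)
           (codeg≤q : ∀ {x y} → x ≢ y → codeg x y ≤ q) where

    ∑deg : ∑ (allFin n) deg ≡ s * k
    ∑deg = begin
      (∑[ x ∈ allFin n ] ∑[ A ∈ F ] mem x A)  ≡⟨ ∑-swap (allFin n) F _ ⟩
      (∑[ A ∈ F ] ∑[ x ∈ allFin n ] mem x A)  ≡⟨ ∑-cong F (λ {A} A∈ → trans (sym (∣∣≡∑mem A)) (uniform A∈)) ⟩
      (∑[ A ∈ F ] k)                          ≡⟨ ∑-const F k ⟩
      s * k                                   ∎
      where open ≡-Reasoning

    -- A meeting pair (A, B) with x ∈ A shares some point y, so the pairs number at most the sum of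
    -- deg y * codeg x y over all y. The term y = x is (deg x)²; every other codegree is at most q,
    -- and the degrees add up to sk.
    star-meet≤ : ∀ x → (∑[ A ∈ F ] mem x A * meet A) ≤ deg x * deg x + s * k * q
    star-meet≤ x with Y , allFin↭ ← ∈⇒↭∷ (∈-allFin x)
                 with x∉Y ∷ _ ← Unique-resp-↭ allFin↭ (Unique.allFin⁺ n) = begin
      (∑[ A ∈ F ] mem x A * meet A)
        ≤⟨ ∑-mono F (λ {A} _ → *-monoʳ-≤ (mem x A) (meet≤∑deg A)) ⟩
      (∑[ A ∈ F ] mem x A * (∑[ y ∈ allFin n ] deg y * mem y A))
        ≡⟨ ∑-mem-swap (allFin n) deg (mem x) ⟩
      (∑[ y ∈ allFin n ] deg y * codeg x y)
        ≡⟨ ∑-↭ _ allFin↭ ⟩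
      deg x * codeg x x + (∑[ y ∈ Y ] deg y * codeg x y)
        ≤⟨ +-mono-≤ (*-monoʳ-≤ (deg x) (≤-reflexive (∑-cong F (λ {A} _ → mem-idem x A))))
                    (∑-mono Y (λ {y} y∈ → *-monoʳ-≤ (deg y) (codeg≤q (All.lookup x∉Y y∈)))) ⟩
      deg x * deg x + (∑[ y ∈ Y ] deg y * q)
        ≡⟨ cong (deg x * deg x +_) (∑-*ʳ Y q deg) ⟩
      deg x * deg x + ∑ Y deg * q
        ≤⟨ +-monoʳ-≤ (deg x * deg x) (*-monoˡ-≤ q (begin
             ∑ Y deg           ≤⟨ m≤n+m _ (deg x) ⟩
             deg x + ∑ Y deg   ≡⟨ sym (∑-↭ deg allFin↭) ⟩
             ∑ (allFin n) deg  ≡⟨ ∑deg ⟩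
             s * k             ∎)) ⟩
      deg x * deg x + s * k * q ∎
      where open ≤-Reasoning

    -- Expanding the square, the diagonal terms give w² deg because an indicator is its own square,
    -- and each off-diagonal term is a codegree, hence at most q. The induction splits off one point
    -- of `Y` at a time.
    second-moment : ∀ {Y : List (Fin n)} → Unique Y → (w : Fin n → ℕ) →
      (∑[ A ∈ F ] (∑[ y ∈ Y ] w y * mem y A) * (∑[ y ∈ Y ] w y * mem y A))
        ≤ (∑[ y ∈ Y ] w y * w y * deg y) + q * (∑ Y w * ∑ Y w)
    second-moment {[]} [] w =
      ≤-trans (≤-reflexive (trans (∑-const F 0) (*-zeroʳ s))) z≤n
    second-moment {y ∷ Y} (y∉Y ∷ u) w = begin
      (∑[ A ∈ F ] (w y * mem y A + f A) * (w y * mem y A + f A))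
        ≡⟨ ∑-cong F (λ {A} _ → expand (w y) (mem y A) (f A) (mem-idem y A)) ⟩
      (∑[ A ∈ F ] w y * w y * mem y A + (2 * w y * (mem y A * f A) + f A * f A))
        ≡⟨ trans (∑-+ F _ _) (cong₂ _+_ (∑-*ˡ F (w y * w y) (mem y))
             (trans (∑-+ F _ _) (cong₂ _+_ (∑-*ˡ F (2 * w y) _) refl))) ⟩
      w y * w y * deg y + (2 * w y * (∑[ A ∈ F ] mem y A * f A) + (∑[ A ∈ F ] f A * f A))
        ≤⟨ +-monoʳ-≤ (w y * w y * deg y) (+-mono-≤ (*-monoʳ-≤ (2 * w y) cross) (second-moment u w)) ⟩
      w y * w y * deg y + (2 * w y * (q * W) + (S + q * (W * W)))
        -- A spare q w² is added so that the q-terms complete the square of w y + W.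
        ≤⟨ m≤m+n _ (q * (w y * w y)) ⟩
      w y * w y * deg y + (2 * w y * (q * W) + (S + q * (W * W))) + q * (w y * w y)
        ≡⟨ collect (w y) (deg y) q W S ⟩
      w y * w y * deg y + S + q * ((w y + W) * (w y + W)) ∎
      where
      open ≤-Reasoning
      f : Subset n → ℕ
      f A = ∑[ z ∈ Y ] w z * mem z A
      W = ∑ Y w
      S = ∑[ z ∈ Y ] w z * w z * deg z
      expand : ∀ a m f → m * m ≡ m → (a * m + f) * (a * m + f) ≡ a * a * m + (2 * a * (m * f) + f * f)
      expand a m f m²≡m = trans (lemma a m f) (cong (λ m′ → a * a * m′ + (2 * a * (m * f) + f * f)) m²≡m)
        where
        lemma : ∀ a m f → (a * m + f) * (a * m + f) ≡ a * a * (m * m) + (2 * a * (m * f) + f * f)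
        lemma = solve-∀
      cross : (∑[ A ∈ F ] mem y A * f A) ≤ q * W
      cross = begin
        (∑[ A ∈ F ] mem y A * f A)     ≡⟨ ∑-mem-swap Y w (mem y) ⟩
        (∑[ z ∈ Y ] w z * codeg y z)   ≤⟨ ∑-mono Y (λ {z} z∈ → *-monoʳ-≤ (w z) (codeg≤q (All.lookup y∉Y z∈))) ⟩
        (∑[ z ∈ Y ] w z * q)           ≡⟨ ∑-*ʳ Y q w ⟩
        W * q                          ≡⟨ *-comm W q ⟩
        q * W                          ∎
      collect : ∀ a d q W S → a * a * d + (2 * a * (q * W) + (S + q * (W * W))) + q * (a * a)
                              ≡ a * a * d + S + q * ((a + W) * (a + W))
      collect = solve-∀

    -- If t is the number of points of `Y` in A, then 2t ≤ 1 + t². Summed over `F`, the left side is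
    -- twice the degree sum, and the second moment with unit weights bounds the right side by s plus
    -- the degree sum plus q|Y|²; one degree sum cancels.
    ∑deg≤ : ∀ {Y : List (Fin n)} → Unique Y → ∑ Y deg ≤ s + q * (length Y * length Y)
    ∑deg≤ {Y} u = +-cancelˡ-≤ (∑ Y deg) _ _ (begin
      ∑ Y deg + ∑ Y deg
        ≡⟨ cong₂ _+_ (sym ∑f) (sym ∑f) ⟩
      ∑ F f + ∑ F f
        ≡⟨ sym (∑-+ F f f) ⟩
      (∑[ A ∈ F ] f A + f A)
        ≤⟨ ∑-mono F (λ {A} _ → ≤-trans (≤-reflexive (lemma₁ (f A))) (2ab≤a²+b² 1 (f A))) ⟩
      (∑[ A ∈ F ] 1 + f A * f A)
        ≡⟨ trans (∑-+ F _ _) (cong₂ _+_ (sym (length-∑ F)) refl) ⟩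
      s + (∑[ A ∈ F ] f A * f A)
        ≤⟨ +-monoʳ-≤ s (second-moment u (λ _ → 1)) ⟩
      s + ((∑[ y ∈ Y ] 1 * 1 * deg y) + q * ((∑[ _ ∈ Y ] 1) * (∑[ _ ∈ Y ] 1)))
        ≡⟨ cong (s +_) (cong₂ _+_ (∑-cong Y (λ _ → *-identityˡ _))
             (cong (λ m → q * (m * m)) (sym (length-∑ Y)))) ⟩
      s + (∑ Y deg + q * (length Y * length Y))
        ≡⟨ lemma₂ s (∑ Y deg) (q * (length Y * length Y)) ⟩
      ∑ Y deg + (s + q * (length Y * length Y)) ∎)
      where
      open ≤-Reasoning
      f : Subset n → ℕ
      f A = ∑[ y ∈ Y ] 1 * mem y A
      ∑f : ∑ F f ≡ ∑ Y deg
      ∑f = trans (∑-weights Y (λ _ → 1)) (∑-cong Y (λ _ → *-identityˡ _))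
      lemma₁ : ∀ a → a + a ≡ 2 * 1 * a
      lemma₁ = solve-∀
      lemma₂ : ∀ a b c → a + (b + c) ≡ b + (a + c)
      lemma₂ = solve-∀

-- A small cover

-- The arithmetic of the cover argument, kept apart from the families: s is the size of the family,
-- d its largest degree, q a bound on codegrees, and r the number of points the cover may have. All
-- errors are expressed in `a`, and `H₀` says 54(k + r)a ≤ s.
module Bounds {s d r k q : ℕ} (0<s : 0 < s) (0<r : 0 < r) (0<k : 0 < k)
              (H₀ : 54 * (r * r * k * q * (k + r)) ≤ s) where

  instance
    s≢0 : NonZero s
    s≢0 = >-nonZero 0<s

  a : ℕ
  a = r * r * k * q

  54ka≤s : 54 * (k * a) ≤ s
  54ka≤s = ≤-trans (m≤m+n _ (54 * (r * a))) (≤-trans (≤-reflexive (lemma a k r)) H₀)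
    where
    lemma : ∀ a k r → 54 * (k * a) + 54 * (r * a) ≡ 54 * (a * (k + r))
    lemma = solve-∀

  54ra≤s : 54 * (r * a) ≤ s
  54ra≤s = ≤-trans (m≤m+n _ (54 * (k * a))) (≤-trans (≤-reflexive (lemma a k r)) H₀)
    where
    lemma : ∀ a k r → 54 * (r * a) + 54 * (k * a) ≡ 54 * (a * (k + r))
    lemma = solve-∀

  -- Here p stands for the sum of the squared degrees, and the last premise is the second moment
  -- estimate. With s = rd + e it becomes (s + e)rp ≤ s³ + s²ka after cancelling rd * rp; since rp ≥
  -- s², this leaves e ≤ ka.
  max-degree≥ : ∀ p → s * s ≤ r * p →
    2 * s * (r * p) ≤ s * (s * s) + (r * r * (d * p) + q * (r * (s * k) * (r * (s * k)))) →
    s ≤ r * d + k * a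
  max-degree≥ p s²≤rp h with ≤-total s (r * d)
  ... | inj₁ s≤rd = ≤-trans s≤rd (m≤m+n _ _)
  ... | inj₂ rd≤s = ≤-trans (≤-reflexive s≡) (+-monoʳ-≤ (r * d) e≤ka)
    where
    e = s ∸ r * d
    s≡ : s ≡ r * d + e
    s≡ = sym (m+[n∸m]≡n rd≤s)
    h′ : r * d * (r * p) + s * (r * p) + e * (r * p) ≤ s * (s * s) + r * d * (r * p) + s * s * (k * a)
    h′ = begin
      r * d * (r * p) + s * (r * p) + e * (r * p)  ≡⟨ lemma₁ (r * d) s e (r * p) ⟩
      (r * d + e) * (r * p) + s * (r * p)          ≡⟨ cong (λ t → t * (r * p) + s * (r * p)) (sym s≡) ⟩
      s * (r * p) + s * (r * p)                    ≡⟨ lemma₂ s (r * p) ⟩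
      2 * s * (r * p)                              ≤⟨ h ⟩
      s * (s * s) + (r * r * (d * p) + q * (r * (s * k) * (r * (s * k))))
        ≡⟨ lemma₃ s r d p q k ⟩
      s * (s * s) + r * d * (r * p) + s * s * (k * (r * r * k * q)) ∎
      where
      open ≤-Reasoning
      lemma₁ : ∀ x s e t → x * t + s * t + e * t ≡ (x + e) * t + s * t
      lemma₁ = solve-∀
      lemma₂ : ∀ s t → s * t + s * t ≡ 2 * s * t
      lemma₂ = solve-∀
      lemma₃ : ∀ s r d p q k → s * (s * s) + (r * r * (d * p) + q * (r * (s * k) * (r * (s * k))))
               ≡ s * (s * s) + r * d * (r * p) + s * s * (k * (r * r * k * q))
      lemma₃ = solve-∀
    e≤ka : e ≤ k * a
    e≤ka = *-cancelˡ-≤ s (*-cancelˡ-≤ s (linear (≤-reflexive (lemma s e (r * d * (r * p)) (k * a)))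
      (≤-trans (+-mono-≤ (+-monoʳ-≤ (r * d * (r * p)) (*-monoʳ-≤ s s²≤rp)) (*-monoʳ-≤ e s²≤rp)) h′)))
      where
      lemma : ∀ s e x c → s * (s * e) + (s * (s * s) + x + s * s * c) ≡ s * (s * c) + (x + s * (s * s) + e * (s * s))
      lemma = solve-∀

  4s≤5rd : s ≤ r * d + k * a → 4 * s ≤ 5 * (r * d)
  4s≤5rd h = linear (≤-reflexive (lemma s (r * d) (k * a)))
    (+-mono-≤ (*-monoʳ-≤ 5 h) (≤-trans (*-monoˡ-≤ (k * a) {5} {54} (m≤m+n 5 49)) 54ka≤s))
    where
    lemma : ∀ s x c → 4 * s + (5 * (x + c) + s) ≡ 5 * x + (5 * s + 5 * c)
    lemma = solve-∀

  module _ (4s≤5rd : 4 * s ≤ 5 * (r * d)) where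

    s≤2rd : s ≤ 2 * (r * d)
    s≤2rd = *-cancelˡ-≤ 4 (≤-trans 4s≤5rd (≤-trans (m≤m+n _ (3 * (r * d))) (≤-reflexive (lemma (r * d)))))
      where
      lemma : ∀ x → 5 * x + 3 * x ≡ 4 * (2 * x)
      lemma = solve-∀

    0<d : 0 < d
    0<d = n≢0⇒n>0 λ { refl → <-irrefl refl (<-≤-trans 0<s
      (≤-trans s≤2rd (≤-reflexive (trans (cong (2 *_) (*-zeroʳ r)) refl)))) }

    instance
      d≢0 : NonZero d
      d≢0 = >-nonZero 0<d

    -- Otherwise s ≤ 2rd gives s² ≤ 4r²d² ≤ 8ska, while 54ka ≤ s gives 54 * 8ska ≤ 8s². The surplus
    -- 46 is 54 - 8.
    ¬all-light : k * (2 * (s * k * q)) < d * d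
    ¬all-light = ≰⇒> λ d²≤ → <-irrefl refl (<-≤-trans (*-mono-< {0} 0<s 0<s) (≤-trans (m≤n*m (s * s) 46)
      (linear (≤-reflexive (lemma₁ (s * s))) (≤-trans (≤-trans (*-monoʳ-≤ 54 (begin
        s * s                              ≤⟨ *-mono-≤ s≤2rd s≤2rd ⟩
        2 * (r * d) * (2 * (r * d))        ≡⟨ lemma₂ r d ⟩
        4 * (r * r) * (d * d)              ≤⟨ *-monoʳ-≤ (4 * (r * r)) d²≤ ⟩
        4 * (r * r) * (k * (2 * (s * k * q)))  ≡⟨ lemma₃ r k q s ⟩
        8 * s * (k * (r * r * k * q))      ∎)) (≤-reflexive (lemma₄ s (k * a))))
      (≤-trans (*-monoʳ-≤ (8 * s) 54ka≤s) (≤-reflexive (*-assoc 8 s s)))))))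
      where
      open ≤-Reasoning
      lemma₁ : ∀ x → 46 * x + 8 * x ≡ 0 + 54 * x
      lemma₁ = solve-∀
      lemma₂ : ∀ r d → 2 * (r * d) * (2 * (r * d)) ≡ 4 * (r * r) * (d * d)
      lemma₂ = solve-∀
      lemma₃ : ∀ r k q s → 4 * (r * r) * (k * (2 * (s * k * q))) ≡ 8 * s * (k * (r * r * k * q))
      lemma₃ = solve-∀
      lemma₄ : ∀ s c → 54 * (8 * s * c) ≡ 8 * s * (54 * c)
      lemma₄ = solve-∀

    module _ {m} (m≤2r : m ≤ 2 * r) where

      qm²≤4a : q * (m * m) ≤ 4 * a
      qm²≤4a = begin
        q * (m * m)              ≤⟨ *-monoʳ-≤ q (*-mono-≤ m≤2r m≤2r) ⟩
        q * (2 * r * (2 * r))    ≡⟨ lemma q r ⟩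
        4 * (r * r * 1 * q)      ≤⟨ *-monoʳ-≤ 4 (*-monoˡ-≤ q (*-monoʳ-≤ (r * r) 0<k)) ⟩
        4 * a                    ∎
        where
        open ≤-Reasoning
        lemma : ∀ q r → q * (2 * r * (2 * r)) ≡ 4 * (r * r * 1 * q)
        lemma = solve-∀

      mrkq≤2a : m * (r * k * q) ≤ 2 * a
      mrkq≤2a = ≤-trans (*-monoˡ-≤ (r * k * q) m≤2r) (≤-reflexive (lemma r k q))
        where
        lemma : ∀ r k q → 2 * r * (r * k * q) ≡ 2 * (r * r * k * q)
        lemma = solve-∀

      -- The premise is the heavy alternative summed over m points. Replacing s by 2rd in its last
      -- term makes everything divisible by d; the remaining errors are qm² ≤ 4a and 4 * mrkq ≤ 8a.
      heavy-count : m * (d * d) ≤ d * (s + q * (m * m)) + m * (2 * (s * k * q)) → m * d ≤ s + 12 * a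
      heavy-count h = *-cancelˡ-≤ d (begin
        d * (m * d)
          ≡⟨ lemma₁ d m ⟩
        m * (d * d)
          ≤⟨ h ⟩
        d * (s + q * (m * m)) + m * (2 * (s * k * q))
          ≤⟨ +-monoʳ-≤ (d * (s + q * (m * m))) (*-monoʳ-≤ m (*-monoʳ-≤ 2 (*-monoˡ-≤ q (*-monoˡ-≤ k s≤2rd)))) ⟩
        d * (s + q * (m * m)) + m * (2 * (2 * (r * d) * k * q))
          ≡⟨ lemma₂ d s (q * (m * m)) m r k q ⟩
        d * (s + q * (m * m) + 4 * (m * (r * k * q)))
          ≤⟨ *-monoʳ-≤ d (+-mono-≤ (+-monoʳ-≤ s qm²≤4a) (*-monoʳ-≤ 4 mrkq≤2a)) ⟩
        d * (s + 4 * a + 4 * (2 * a))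
          ≡⟨ cong (d *_) (lemma₃ s a) ⟩
        d * (s + 12 * a) ∎)
        where
        open ≤-Reasoning
        lemma₁ : ∀ d m → d * (m * d) ≡ m * (d * d)
        lemma₁ = solve-∀
        lemma₂ : ∀ d s t m r k q → d * (s + t) + m * (2 * (2 * (r * d) * k * q))
                                   ≡ d * (s + t + 4 * (m * (r * k * q)))
        lemma₂ = solve-∀
        lemma₃ : ∀ s a → s + 4 * a + 4 * (2 * a) ≡ s + 12 * a
        lemma₃ = solve-∀

      -- The sharper bound on d. The premise on s² comes from counting meeting pairs through m
      -- covering points. Its errors are at most 2s * 4a and s * 2a, so the loss is 10a where
      -- `max-degree≥` loses ka.
      max-degree≥′ : r * d ≤ 2 * s → s * s ≤ r * (d * (s + q * (m * m)) + m * (s * k * q)) →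
        s ≤ r * d + 10 * a
      max-degree≥′ rd≤2s h = *-cancelˡ-≤ s (begin
        s * s
          ≤⟨ h ⟩
        r * (d * (s + q * (m * m)) + m * (s * k * q))
          ≡⟨ lemma₁ r d s (q * (m * m)) m k q ⟩
        s * (r * d) + r * d * (q * (m * m)) + s * (m * (r * k * q))
          ≤⟨ +-mono-≤ (+-monoʳ-≤ (s * (r * d)) (*-mono-≤ rd≤2s qm²≤4a)) (*-monoʳ-≤ s mrkq≤2a) ⟩
        s * (r * d) + 2 * s * (4 * a) + s * (2 * a)
          ≡⟨ lemma₂ s (r * d) a ⟩
        s * (r * d + 10 * a) ∎)
        where
        open ≤-Reasoning
        lemma₁ : ∀ r d s t m k q → r * (d * (s + t) + m * (s * k * q))
                                   ≡ s * (r * d) + r * d * t + s * (m * (r * k * q))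
        lemma₁ = solve-∀
        lemma₂ : ∀ s x a → s * x + 2 * s * (4 * a) + s * (2 * a) ≡ s * (x + 10 * a)
        lemma₂ = solve-∀

    a≤ra : a ≤ r * a
    a≤ra = m≤n*m a r {{>-nonZero 0<r}}

    -- If 2rd ≤ s + 12a, then 36 times 4s ≤ 5rd, 90 times that inequality and 20 times 54ra ≤ s add
    -- up to 144s ≤ 110s.
    ¬2r-heavy : s + 12 * a < 2 * r * d
    ¬2r-heavy = ≰⇒> λ h → <-irrefl refl (<-≤-trans 0<s (linear {0 + s} {0}
      (≤-reflexive (lemma s (r * d) (r * a))) (+-mono-≤ (*-monoʳ-≤ 36 4s≤5rd) (+-mono-≤
        (*-monoʳ-≤ 90 (≤-trans (≤-reflexive (lemma₂ r d)) (≤-trans h (+-monoʳ-≤ s (*-monoʳ-≤ 12 a≤ra)))))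
        (≤-trans (*-monoʳ-≤ 20 54ra≤s) (m≤m+n (20 * s) (33 * s)))))))
      where
      lemma : ∀ s x b → 0 + s + (36 * (5 * x) + (90 * (s + 12 * b) + (20 * s + 33 * s)))
                        ≡ 0 + (36 * (4 * s) + (90 * (2 * x) + 20 * (54 * b)))
      lemma = solve-∀
      lemma₂ : ∀ r d → 2 * (r * d) ≡ 2 * r * d
      lemma₂ = solve-∀

    -- Eliminating d between s ≤ rd + 10a and (r + 1)d ≤ s + 12a gives s ≤ (22r + 10)a ≤ 32ra,
    -- against 54ra ≤ s. Multiplied by 54, this is the 22s ≤ 0 of the proof. A loss of ka in place
    -- of 10a would leave an error of order rka here.
    ¬r+1-heavy : s ≤ r * d + 10 * a → s + 12 * a < suc r * d
    ¬r+1-heavy s≤ = ≰⇒> λ h → <-irrefl refl (<-≤-trans 0<s (*-cancelˡ-≤ 22 (linear {22 * s} {22 * 0}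
      (≤-reflexive (lemma s r d a))
      (+-mono-≤ (*-monoʳ-≤ (54 * suc r) s≤)
        (+-mono-≤ (*-monoʳ-≤ (54 * r) h) (+-mono-≤ (*-monoʳ-≤ 32 54ra≤s) (*-monoʳ-≤ 540 a≤ra)))))))
      where
      lemma : ∀ s r d a → 22 * s + (54 * suc r * (r * d + 10 * a) + (54 * r * (s + 12 * a) + (32 * s + 540 * (r * a))))
              ≡ 22 * 0 + (54 * suc r * s + (54 * r * (suc r * d) + (32 * (54 * (r * a)) + 540 * a)))
      lemma = solve-∀

-- The premise says g(d - g) ≤ c. The larger of g and d - g is at least d/2, so the smaller is at
-- most 2c/d; both conclusions are multiplied by d.
heavy-or-light : ∀ {d g c} → d * g ≤ g * g + c → g ≤ d →
  (d ≤ 2 * g → d * d ≤ d * g + 2 * c) × (2 * g ≤ d → d * g ≤ 2 * c)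
heavy-or-light {d} {g} {c} h g≤d = heavy , light
  where
  e = d ∸ g
  d≡ : d ≡ g + e
  d≡ = sym (m+[n∸m]≡n g≤d)
  heavy : d ≤ 2 * g → d * d ≤ d * g + 2 * c
  heavy d≤2g = linear {L = 2 * (d * g) + d * e} {R = 2 * (g * g + c) + 2 * g * e}
    (≤-reflexive (trans (cong (λ d → d * d + (2 * (g * g + c) + 2 * g * e)) d≡)
      (trans (lemma g e c) (cong (λ d → d * g + 2 * c + (2 * (d * g) + d * e)) (sym d≡)))))
    (+-mono-≤ (*-monoʳ-≤ 2 h) (*-monoˡ-≤ e d≤2g))
    where
    lemma : ∀ g e c → (g + e) * (g + e) + (2 * (g * g + c) + 2 * g * e)
                      ≡ (g + e) * g + 2 * c + (2 * ((g + e) * g) + (g + e) * e)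
    lemma = solve-∀
  light : 2 * g ≤ d → d * g ≤ 2 * c
  light 2g≤d = linear {L = 2 * (d * g) + 2 * g * g} {R = 2 * (g * g + c) + d * g}
    (≤-reflexive (lemma (d * g) g c))
    (+-mono-≤ (*-monoʳ-≤ 2 h) (*-monoˡ-≤ g 2g≤d))
    where
    lemma : ∀ x g c → x + (2 * (g * g + c) + x) ≡ 2 * c + (2 * x + 2 * g * g)
    lemma = solve-∀

∣∣≡length-filter : ∀ {n} {P : Fin n → Set} (P? : Decidable P) →
  ∣ tabulate (λ x → does (P? x)) ∣ ≡ length (filter P? (allFin n))
∣∣≡length-filter {n} P? = begin
  ∣ tabulate (λ x → does (P? x)) ∣
    ≡⟨ ∣∣≡∑mem (tabulate (λ x → does (P? x))) ⟩
  (∑[ x ∈ allFin n ] mem x (tabulate (λ x → does (P? x))))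
    ≡⟨ ∑-cong (allFin n) (λ {x} _ → trans (cong ⟦_⟧ (lookup∘tabulate _ x)) (sym (*-identityʳ _))) ⟩
  (∑[ x ∈ allFin n ] ⟦ does (P? x) ⟧ * 1)
    ≡⟨ sym (∑-filter P? (allFin n) _) ⟩
  (∑[ _ ∈ filter P? (allFin n) ] 1)
    ≡⟨ sym (length-∑ (filter P? (allFin n))) ⟩
  length (filter P? (allFin n)) ∎
  where open ≡-Reasoning

module SmallCover
  {n} (F : List (Subset n)) {d r k q : ℕ}
  (uniform : ∀ {A} → A ∈ F → ∣ A ∣ ≡ k) (codeg≤q : ∀ {x y} → x ≢ y → Degrees.codeg F x y ≤ q)
  (0<s : 0 < length F) (0<r : 0 < r) (0<k : 0 < k)
  (H₀ : 54 * (r * r * k * q * (k + r)) ≤ length F)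
  (deg≤d : ∀ x → Degrees.deg F x ≤ d) (d≤meet : ∀ {A} → A ∈ F → d ≤ Degrees.meet F A)
  (rd≤2s : r * d ≤ 2 * length F) (s²≤r∑meet : length F * length F ≤ r * ∑ F (Degrees.meet F))
  where

  open Degrees F

  open Bounds {s} {d} {r} {k} {q} 0<s 0<r 0<k H₀

  P₂ : ℕ
  P₂ = ∑[ x ∈ allFin n ] deg x * deg x

  ∑meet≤P₂ : ∑ F meet ≤ P₂
  ∑meet≤P₂ = ≤-trans (∑-mono F (λ {A} _ → meet≤∑deg A)) (≤-reflexive (∑-weights (allFin n) deg))

  -- The weight r * deg x, averaged over F against the constant s by 2ab ≤ a² + b².
  second-moment-deg : 2 * s * (r * P₂) ≤ s * (s * s) + (r * r * (d * P₂) + q * (r * (s * k) * (r * (s * k))))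
  second-moment-deg = begin
    2 * s * (r * P₂)
      ≡⟨ cong (2 * s *_) (trans (sym (∑-*ˡ (allFin n) r _))
           (∑-cong (allFin n) (λ {x} _ → sym (*-assoc r (deg x) (deg x))))) ⟩
    2 * s * (∑[ x ∈ allFin n ] w x * deg x)
      ≡⟨ cong (2 * s *_) (sym (∑-weights (allFin n) w)) ⟩
    2 * s * ∑ F f
      ≡⟨ sym (∑-*ˡ F (2 * s) f) ⟩
    (∑[ A ∈ F ] 2 * s * f A)
      ≤⟨ ∑-mono F (λ {A} _ → 2ab≤a²+b² s (f A)) ⟩
    (∑[ A ∈ F ] s * s + f A * f A)
      ≡⟨ trans (∑-+ F _ _) (cong₂ _+_ (∑-const F (s * s)) refl) ⟩
    s * (s * s) + (∑[ A ∈ F ] f A * f A)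
      ≤⟨ +-monoʳ-≤ (s * (s * s)) (second-moment k q uniform codeg≤q (Unique.allFin⁺ n) w) ⟩
    s * (s * s) + ((∑[ x ∈ allFin n ] w x * w x * deg x) + q * (∑ (allFin n) w * ∑ (allFin n) w))
      ≤⟨ +-monoʳ-≤ (s * (s * s)) (+-mono-≤ cubes (≤-reflexive (cong (λ t → q * (t * t)) ∑w))) ⟩
    s * (s * s) + (r * r * (d * P₂) + q * (r * (s * k) * (r * (s * k)))) ∎
    where
    open ≤-Reasoning
    w : Fin n → ℕ
    w x = r * deg x
    f : Subset n → ℕ
    f A = ∑[ x ∈ allFin n ] w x * mem x A
    ∑w : ∑ (allFin n) w ≡ r * (s * k)
    ∑w = trans (∑-*ˡ (allFin n) r deg) (cong (r *_) (∑deg k q uniform codeg≤q))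
    lemma : ∀ r g d → r * g * (r * g) * d ≡ r * r * (d * (g * g))
    lemma = solve-∀
    cubes : (∑[ x ∈ allFin n ] w x * w x * deg x) ≤ r * r * (d * P₂)
    cubes = begin
      (∑[ x ∈ allFin n ] w x * w x * deg x)
        ≤⟨ ∑-mono (allFin n) (λ {x} _ → *-monoʳ-≤ (w x * w x) (deg≤d x)) ⟩
      (∑[ x ∈ allFin n ] w x * w x * d)
        ≡⟨ ∑-cong (allFin n) (λ {x} _ → lemma r (deg x) d) ⟩
      (∑[ x ∈ allFin n ] r * r * (d * (deg x * deg x)))
        ≡⟨ trans (∑-*ˡ (allFin n) (r * r) _) (cong (r * r *_) (∑-*ˡ (allFin n) d _)) ⟩
      r * r * (d * P₂) ∎

  4s≤5rd′ : 4 * s ≤ 5 * (r * d)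
  4s≤5rd′ = 4s≤5rd (max-degree≥ P₂ (≤-trans s²≤r∑meet (*-monoʳ-≤ r ∑meet≤P₂)) second-moment-deg)

  deg-dichotomy : ∀ x → (d ≤ 2 * deg x → d * d ≤ d * deg x + 2 * (s * k * q)) ×
    (2 * deg x ≤ d → d * deg x ≤ 2 * (s * k * q))
  deg-dichotomy x = heavy-or-light (begin
    d * deg x                     ≡⟨ trans (*-comm d (deg x)) (sym (∑-*ʳ F d (mem x))) ⟩
    (∑[ A ∈ F ] mem x A * d)      ≤⟨ ∑-mono F (λ {A} A∈ → *-monoʳ-≤ (mem x A) (d≤meet A∈)) ⟩
    (∑[ A ∈ F ] mem x A * meet A) ≤⟨ star-meet≤ k q uniform codeg≤q x ⟩
    deg x * deg x + s * k * q     ∎) (deg≤d x)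
    where open ≤-Reasoning

  heavy? : Decidable (λ x → d ≤ 2 * deg x)
  heavy? x = d ≤? 2 * deg x

  -- The heavy points are kept in two forms: as a subset, to speak of covering, and as the list `Xs`
  -- without repetitions, to sum over them.
  X : Subset n
  X = tabulate (λ x → does (heavy? x))

  Xs : List (Fin n)
  Xs = filter heavy? (allFin n)

  -- A member avoiding `X` has k light points, each with d * deg x ≤ 2skq. It meets at most the sum
  -- of these degrees, yet at least d members, so d² ≤ k * 2skq, which `¬all-light` excludes.
  covers : ∀ {A} → A ∈ F → disjointᵇ X A ≡ false
  covers {A} A∈ with disjointᵇ X A in X∩A
  ... | false = refl
  ... | true  = contradiction (begin
    d * d
      ≤⟨ *-monoʳ-≤ d (≤-trans (d≤meet A∈) (meet≤∑deg A)) ⟩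
    d * (∑[ x ∈ allFin n ] deg x * mem x A)
      ≡⟨ sym (∑-*ˡ (allFin n) d _) ⟩
    (∑[ x ∈ allFin n ] d * (deg x * mem x A))
      ≤⟨ ∑-mono (allFin n) (λ {x} _ → light x) ⟩
    (∑[ x ∈ allFin n ] mem x A * (2 * (s * k * q)))
      ≡⟨ trans (∑-*ʳ (allFin n) _ _) (cong (_* (2 * (s * k * q))) (trans (sym (∣∣≡∑mem A)) (uniform A∈))) ⟩
    k * (2 * (s * k * q)) ∎) (<⇒≱ (¬all-light 4s≤5rd′))
    where
    open ≤-Reasoning
    avoids : ∀ x → mem x X * mem x A ≤ 0
    avoids x = ≤-trans (mem*mem≤ι x X A) (≤-reflexive (cong (λ b → ⟦ not b ⟧) X∩A))
    light : ∀ x → d * (deg x * mem x A) ≤ mem x A * (2 * (s * k * q))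
    light x with lookup A x | avoids x
    ... | false | _ = ≤-trans (≤-reflexive (trans (cong (d *_) (*-zeroʳ (deg x))) (*-zeroʳ d))) z≤n
    ... | true  | h with heavy? x in hx
    ...   | no  ¬heavy = ≤-trans (≤-reflexive (cong (d *_) (*-identityʳ (deg x))))
                         (≤-trans (proj₂ (deg-dichotomy x) (<⇒≤ (≰⇒> ¬heavy))) (≤-reflexive (sym (*-identityˡ _))))
    ...   | yes heavy  = contradiction h (<⇒≱ (subst (λ b → 0 < ⟦ b ⟧ * 1)
                           (sym (trans (lookup∘tabulate _ x) (cong does hx))) (s≤s z≤n)))

  heavy-length : ∀ {Y} → Unique Y → All (λ x → d ≤ 2 * deg x) Y →
    length Y * (d * d) ≤ d * (s + q * (length Y * length Y)) + length Y * (2 * (s * k * q))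
  heavy-length {Y} u heavy = begin
    length Y * (d * d)
      ≤⟨ ∑-≥-const Y (d * d) (λ {x} x∈ → proj₁ (deg-dichotomy x) (All.lookup heavy x∈)) ⟩
    (∑[ x ∈ Y ] d * deg x + 2 * (s * k * q))
      ≡⟨ trans (∑-+ Y _ _) (cong₂ _+_ (∑-*ˡ Y d deg) (∑-const Y _)) ⟩
    d * ∑ Y deg + length Y * (2 * (s * k * q))
      ≤⟨ +-monoˡ-≤ _ (*-monoʳ-≤ d (∑deg≤ k q uniform codeg≤q u)) ⟩
    d * (s + q * (length Y * length Y)) + length Y * (2 * (s * k * q)) ∎
    where open ≤-Reasoning

  Xs-unique : Unique Xs
  Xs-unique = Unique.filter⁺ heavy? (Unique.allFin⁺ n)

  -- The error q m² is under control only for m ≤ 2r. If there were more heavy points, exactly 2r of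
  -- them are selected and the count is applied to those.
  ∣Xs∣<2r : length Xs < 2 * r
  ∣Xs∣<2r = ≰⇒> λ 2r≤ →
    let len : length (take (2 * r) Xs) ≡ 2 * r
        len = trans (length-take (2 * r) Xs) (m≤n⇒m⊓n≡m 2r≤)
    in contradiction
      (subst (λ m → m * d ≤ s + 12 * a) len
        (heavy-count 4s≤5rd′ (≤-reflexive len)
          (heavy-length (Unique.take⁺ (2 * r) Xs-unique) (take⁺ (2 * r) (all-filter heavy? (allFin n))))))
      (<⇒≱ (¬2r-heavy 4s≤5rd′))

  -- Every member contains a heavy point, so the meeting pairs are covered by the stars of `Xs`,
  -- each bounded by `star-meet≤`. Set against `s²≤r∑meet`, this yields the sharper bound on d.
  ∑meet≤ : ∑ F meet ≤ d * (s + q * (length Xs * length Xs)) + length Xs * (s * k * q)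
  ∑meet≤ = begin
    (∑[ A ∈ F ] meet A)
      ≤⟨ ∑-mono F (λ {A} A∈ → ≤-trans (≤-reflexive (sym (*-identityˡ (meet A)))) (*-monoˡ-≤ (meet A) (hit A∈))) ⟩
    (∑[ A ∈ F ] (∑[ x ∈ Xs ] mem x A) * meet A)
      ≡⟨ ∑-cong F (λ {A} _ → sym (∑-*ʳ Xs (meet A) _)) ⟩
    (∑[ A ∈ F ] ∑[ x ∈ Xs ] mem x A * meet A)
      ≡⟨ ∑-swap F Xs _ ⟩
    (∑[ x ∈ Xs ] ∑[ A ∈ F ] mem x A * meet A)
      ≤⟨ ∑-mono Xs (λ {x} _ → ≤-trans (star-meet≤ k q uniform codeg≤q x)
           (+-monoˡ-≤ _ (*-monoˡ-≤ (deg x) (deg≤d x)))) ⟩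
    (∑[ x ∈ Xs ] d * deg x + s * k * q)
      ≡⟨ trans (∑-+ Xs _ _) (cong₂ _+_ (∑-*ˡ Xs d deg) (∑-const Xs _)) ⟩
    d * ∑ Xs deg + length Xs * (s * k * q)
      ≤⟨ +-monoˡ-≤ _ (*-monoʳ-≤ d (∑deg≤ k q uniform codeg≤q Xs-unique)) ⟩
    d * (s + q * (length Xs * length Xs)) + length Xs * (s * k * q) ∎
    where
    open ≤-Reasoning
    hit : ∀ {A} → A ∈ F → 1 ≤ (∑[ x ∈ Xs ] mem x A)
    hit {A} A∈ = begin
      1
        ≡⟨ cong (λ b → ⟦ not b ⟧) (sym (covers A∈)) ⟩
      ι X A
        ≤⟨ ι≤∑mem X A ⟩
      (∑[ x ∈ allFin n ] mem x X * mem x A)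
        ≡⟨ ∑-cong (allFin n) (λ {x} _ → cong (λ b → ⟦ b ⟧ * mem x A) (lookup∘tabulate _ x)) ⟩
      (∑[ x ∈ allFin n ] ⟦ does (heavy? x) ⟧ * mem x A)
        ≡⟨ sym (∑-filter heavy? (allFin n) _) ⟩
      (∑[ x ∈ Xs ] mem x A) ∎

  ∣X∣≤r : ∣ X ∣ ≤ r
  ∣X∣≤r = subst (_≤ r) (sym (∣∣≡length-filter heavy?)) (≮⇒≥ λ r<∣Xs∣ → contradiction
    (≤-trans (*-monoˡ-≤ d r<∣Xs∣)
      (heavy-count 4s≤5rd′ (<⇒≤ ∣Xs∣<2r) (heavy-length Xs-unique (all-filter heavy? (allFin n)))))
    (<⇒≱ (¬r+1-heavy 4s≤5rd′
      (max-degree≥′ 4s≤5rd′ (<⇒≤ ∣Xs∣<2r) rd≤2s (≤-trans s²≤r∑meet (*-monoʳ-≤ r ∑meet≤))))))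

-- Disjoint pairs and complements

avoid : List (Subset n) → Subset n → ℕ
avoid F A = ∑[ B ∈ F ] δ A B

D : List (Subset n) → List (Subset n) → ℕ
D F G = ∑[ A ∈ F ] avoid G A

D-sym : ∀ (F G : List (Subset n)) → D F G ≡ D G F
D-sym F G = trans (∑-swap F G _) (∑-cong G (λ {B} _ → ∑-cong F (λ {A} _ → δ-sym A B)))

D-++ˡ : ∀ (F G H : List (Subset n)) → D (F ++ G) H ≡ D F H + D G H
D-++ˡ F G H = ∑-++ F G (avoid H)

D-++ʳ : ∀ (F G H : List (Subset n)) → D F (G ++ H) ≡ D F G + D F H
D-++ʳ F G H = trans (∑-cong F (λ {A} _ → ∑-++ G H (δ A))) (∑-+ F _ _)

D-++ : ∀ (F G : List (Subset n)) → D (F ++ G) (F ++ G) ≡ D F F + 2 * D F G + D G G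
D-++ F G = begin
  D (F ++ G) (F ++ G)                   ≡⟨ D-++ˡ F G (F ++ G) ⟩
  D F (F ++ G) + D G (F ++ G)           ≡⟨ cong₂ _+_ (D-++ʳ F F G) (D-++ʳ G F G) ⟩
  D F F + D F G + (D G F + D G G)       ≡⟨ cong (λ t → D F F + D F G + (t + D G G)) (D-sym G F) ⟩
  D F F + D F G + (D F G + D G G)       ≡⟨ lemma (D F F) (D F G) (D G G) ⟩
  D F F + 2 * D F G + D G G             ∎
  where
  open ≡-Reasoning
  lemma : ∀ a b c → a + b + (b + c) ≡ a + 2 * b + c
  lemma = solve-∀

D-↭ : ∀ {F G : List (Subset n)} → F ↭ G → D F F ≡ D G G
D-↭ {F = F} {G} p = trans (∑-↭ _ p) (∑-cong G (λ {A} _ → ∑-↭ (δ A) p))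

D-map-outside : ∀ (F G : List (Subset n)) → D (map (outside ∷_) F) (map (outside ∷_) G) ≡ D F G
D-map-outside F G = trans (∑-map _ F _) (∑-cong F (λ _ → ∑-map _ G _))

D-map-inside-outside : ∀ (F G : List (Subset n)) → D (map (inside ∷_) F) (map (outside ∷_) G) ≡ D F G
D-map-inside-outside F G = trans (∑-map _ F _) (∑-cong F (λ _ → ∑-map _ G _))

D-map-inside : ∀ (F G : List (Subset n)) → D (map (inside ∷_) F) (map (inside ∷_) G) ≡ 0
D-map-inside F G = trans (∑-map _ F _)
  (trans (∑-cong F (λ _ → trans (∑-map _ G _) (trans (∑-const G 0) (*-zeroʳ (length G)))))
         (trans (∑-const F 0) (*-zeroʳ (length F))))

length-filter-δ : ∀ (A : Subset n) F → length (filter (λ B → T? (disjointᵇ A B)) F) ≡ avoid F A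
length-filter-δ A F = begin
  length (filter P? F)          ≡⟨ length-∑ (filter P? F) ⟩
  (∑[ _ ∈ filter P? F ] 1)      ≡⟨ ∑-filter P? F _ ⟩
  (∑[ B ∈ F ] δ A B * 1)        ≡⟨ ∑-cong F (λ _ → *-identityʳ _) ⟩
  avoid F A                     ∎
  where
  open ≡-Reasoning
  P? = λ B → T? (disjointᵇ A B)

disj-∷ : ∀ (A : Subset n) F → disj (A ∷ F) ≡ avoid F A + disj F
disj-∷ A F = cong (_+ disj F) (length-filter-δ A F)

2disj≡D : ∀ (F : List (Subset n)) → (∀ {A} → A ∈ F → 0 < ∣ A ∣) → 2 * disj F ≡ D F F
2disj≡D []      _ = refl
2disj≡D (A ∷ F) h = begin
  2 * disj (A ∷ F)
    ≡⟨ cong (2 *_) (disj-∷ A F) ⟩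
  2 * (avoid F A + disj F)
    ≡⟨ lemma (avoid F A) (disj F) ⟩
  2 * (avoid F A + 0) + 2 * disj F
    ≡⟨ cong (2 * (avoid F A + 0) +_) (2disj≡D F (h ∘ there)) ⟩
  2 * D (A ∷ []) F + D F F
    ≡⟨ cong (λ t → t + 2 * D (A ∷ []) F + D F F) (sym (cong (λ t → t + 0 + 0) (δ-self A (h (here refl))))) ⟩
  D (A ∷ []) (A ∷ []) + 2 * D (A ∷ []) F + D F F
    ≡⟨ sym (D-++ (A ∷ []) F) ⟩
  D (A ∷ F) (A ∷ F) ∎
  where
  open ≡-Reasoning
  lemma : ∀ a b → 2 * (a + b) ≡ 2 * (a + 0) + 2 * b
  lemma = solve-∀

meet+avoid : ∀ (F : List (Subset n)) A → (∑[ B ∈ F ] ι A B) + avoid F A ≡ length F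
meet+avoid F A = trans (sym (∑-+ F _ _)) (trans (∑-cong F (λ {B} _ → ι+δ A B)) (sym (length-∑ F)))

∑meet+D : ∀ (F : List (Subset n)) → (∑[ A ∈ F ] ∑[ B ∈ F ] ι A B) + D F F ≡ length F * length F
∑meet+D F = trans (sym (∑-+ F _ _)) (trans (∑-cong F (λ {A} _ → meet+avoid F A)) (∑-const F (length F)))

D-kSubsets : ∀ {j} k (F : List (Subset n)) → (∀ {A} → A ∈ F → ∣ A ∣ ≡ j) →
  D F (kSubsets n k) ≡ length F * ((n ∸ j) C k)
D-kSubsets {n} k F h =
  trans (∑-cong F (λ {A} A∈ → trans (count-avoiding n k A) (cong (λ j → (n ∸ j) C k) (h A∈))))
        (∑-const F _)

module _ {n k} (F W : List (Subset n)) (U↭ : kSubsets n k ↭ F ++ W) where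

  private U = kSubsets n k

  ∈ˡ-card : ∀ {A} → A ∈ F → ∣ A ∣ ≡ k
  ∈ˡ-card A∈ = ∈-kSubsets⁻ n k (∈-resp-↭ (↭-sym U↭) (∈-++⁺ˡ A∈))

  ∈ʳ-card : ∀ {A} → A ∈ W → ∣ A ∣ ≡ k
  ∈ʳ-card A∈ = ∈-kSubsets⁻ n k (∈-resp-↭ (↭-sym U↭) (∈-++⁺ʳ F A∈))

  ∑-split : ∀ (f : Subset n → ℕ) → ∑ U f ≡ ∑ F f + ∑ W f
  ∑-split f = trans (∑-↭ f U↭) (∑-++ F W f)

  length-split : length F + length W ≡ n C k
  length-split = trans (cong₂ _+_ (length-∑ F) (length-∑ W))
    (trans (sym (∑-split _)) (trans (sym (length-∑ U)) (length-kSubsets n k)))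

  -- Every k-set is disjoint from the same number of k-sets.
  D-complement : D F F + length W * ((n ∸ k) C k) ≡ length F * ((n ∸ k) C k) + D W W
  D-complement = begin
    D F F + length W * c      ≡⟨ cong (D F F +_) (trans (sym (D-kSubsets k W ∈ʳ-card)) (split W)) ⟩
    D F F + (D W F + D W W)   ≡⟨ cong (λ t → D F F + (t + D W W)) (D-sym W F) ⟩
    D F F + (D F W + D W W)   ≡⟨ sym (+-assoc (D F F) (D F W) (D W W)) ⟩
    D F F + D F W + D W W     ≡⟨ cong (_+ D W W) (trans (sym (split F)) (D-kSubsets k F ∈ˡ-card)) ⟩
    length F * c + D W W      ∎
    where
    open ≡-Reasoning
    c = (n ∸ k) C k
    split : ∀ G → D G U ≡ D G F + D G W
    split G = trans (∑-cong G (λ {A} _ → ∑-split (δ A))) (∑-+ G _ _)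

  module _ (X : Subset n) (covers : ∀ {A} → A ∈ F → disjointᵇ X A ≡ false) where

    -- All members of `F` meet `X`, so every k-set avoiding `X` is missing. Sums over these missing
    -- sets are therefore sums over all k-sets avoiding `X`, whatever `F` is.
    ∑-avoiding-cover : ∀ (f : Subset n → ℕ) → (∑[ A ∈ W ] δ X A * f A) ≡ (∑[ A ∈ U ] δ X A * f A)
    ∑-avoiding-cover f = sym (trans (∑-split _) (cong (_+ (∑[ A ∈ W ] δ X A * f A))
      (trans (∑-cong F (λ {A} A∈ → cong (λ b → ⟦ b ⟧ * f A) (covers A∈)))
             (trans (∑-const F 0) (*-zeroʳ (length F))))))

    count-avoiding-cover : (∑[ A ∈ W ] δ X A) ≡ (n ∸ ∣ X ∣) C k
    count-avoiding-cover = begin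
      (∑[ A ∈ W ] δ X A)      ≡⟨ ∑-cong W (λ _ → sym (*-identityʳ _)) ⟩
      (∑[ A ∈ W ] δ X A * 1)  ≡⟨ ∑-avoiding-cover _ ⟩
      (∑[ A ∈ U ] δ X A * 1)  ≡⟨ ∑-cong U (λ _ → *-identityʳ _) ⟩
      (∑[ A ∈ U ] δ X A)      ≡⟨ count-avoiding n k X ⟩
      (n ∸ ∣ X ∣) C k         ∎
      where open ≡-Reasoning

    covered-length : length F + (n ∸ ∣ X ∣) C k ≤ n C k
    covered-length = begin
      length F + (n ∸ ∣ X ∣) C k    ≡⟨ cong (length F +_) (sym count-avoiding-cover) ⟩
      length F + ∑ W (δ X)          ≤⟨ +-monoʳ-≤ (length F) (∑-mono W (λ {A} _ → ⟦⟧≤1 (disjointᵇ X A))) ⟩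
      length F + (∑[ _ ∈ W ] 1)     ≡⟨ cong (length F +_) (sym (length-∑ W)) ⟩
      length F + length W           ≡⟨ length-split ⟩
      n C k                         ∎
      where open ≤-Reasoning

    length-complement : (n ∸ ∣ X ∣) C k + ∑ W (ι X) ≡ length W
    length-complement = begin
      (n ∸ ∣ X ∣) C k + ∑ W (ι X)  ≡⟨ cong (_+ ∑ W (ι X)) (sym count-avoiding-cover) ⟩
      ∑ W (δ X) + ∑ W (ι X)        ≡⟨ +-comm (∑ W (δ X)) _ ⟩
      ∑ W (ι X) + ∑ W (δ X)        ≡⟨ meet+avoid W X ⟩
      length W                     ∎
      where open ≡-Reasoning

    -- `R A` counts the k-sets that avoid both `X` and A, all of which are missing. It depends only
    -- on the size of `X ∪ A`: this is |X| + k if A avoids `X`, and at most |X| + k - 1 if A meets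
    -- it. Pairs with exactly one member meeting `X` occur in both orders, hence the factor 2; pairs
    -- with both members meeting `X` are dropped. The bound is attained when the missing sets that
    -- meet `X` all do so in one and the same point, as in the lexicographic tail.
    D-complement≥ : ∀ {k′} → k ≡ suc k′ →
      ((n ∸ ∣ X ∣) C k) * ((n ∸ (∣ X ∣ + k)) C k) + 2 * (∑ W (ι X) * ((n ∸ (∣ X ∣ + k′)) C k)) ≤ D W W
    D-complement≥ {k′} k≡ = begin
      ((n ∸ ∣ X ∣) C k) * e₁ + 2 * (∑ W (ι X) * e₂)
        ≡⟨ cong (λ t → t * e₁ + 2 * (∑ W (ι X) * e₂)) (sym count-avoiding-cover) ⟩
      ∑ W (δ X) * e₁ + 2 * (∑ W (ι X) * e₂)
        ≡⟨ cong₂ (λ t u → t + 2 * u) (sym (∑-*ʳ W e₁ _)) (sym (∑-*ʳ W e₂ _)) ⟩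
      (∑[ A ∈ W ] δ X A * e₁) + 2 * (∑[ A ∈ W ] ι X A * e₂)
        ≤⟨ +-mono-≤ (∑-mono W (≤-reflexive ∘ δR)) (*-monoʳ-≤ 2 (∑-mono W ιR)) ⟩
      δΣ + 2 * ιΣ
        ≡⟨ lemma₁ δΣ ιΣ ⟩
      δΣ + ιΣ + ιΣ
        ≡⟨ cong (_+ ιΣ) (trans (sym (∑-+ W _ _)) (∑-cong W (λ {A} _ → complementary A))) ⟩
      ∑ W R + ιΣ
        -- Exchanging the two members of a pair turns the sum of all `R A` into the disjoint pairs
        -- whose first member avoids `X`.
        ≡⟨ cong (_+ ιΣ) (trans (∑-swap W W _) (∑-cong W (λ {B} _ →
             trans (∑-*ˡ W (δ X B) (λ A → δ A B)) (cong (δ X B *_) (∑-cong W (λ {A} _ → δ-sym A B)))))) ⟩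
      (∑[ A ∈ W ] δ X A * avoid W A) + ιΣ
        ≤⟨ +-monoʳ-≤ _ (∑-mono W (λ {A} _ → *-monoʳ-≤ (ι X A) (∑-mono W (λ {B} _ →
             ≤-trans (*-monoˡ-≤ (δ A B) (⟦⟧≤1 (disjointᵇ X B))) (≤-reflexive (*-identityˡ _)))))) ⟩
      (∑[ A ∈ W ] δ X A * avoid W A) + (∑[ A ∈ W ] ι X A * avoid W A)
        ≡⟨ sym (∑-+ W _ _) ⟩
      (∑[ A ∈ W ] δ X A * avoid W A + ι X A * avoid W A)
        ≡⟨ ∑-cong W (λ {A} _ → trans (sym (*-distribʳ-+ (avoid W A) (δ X A) (ι X A)))
             (trans (cong (_* avoid W A) (trans (+-comm (δ X A) _) (ι+δ X A))) (*-identityˡ _))) ⟩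
      D W W ∎
      where
      open ≤-Reasoning
      e₁ = (n ∸ (∣ X ∣ + k)) C k
      e₂ = (n ∸ (∣ X ∣ + k′)) C k
      R : Subset n → ℕ
      R A = ∑[ B ∈ W ] δ X B * δ A B
      R≡ : ∀ A → R A ≡ (n ∸ ∣ X ∪ A ∣) C k
      R≡ A = trans (∑-avoiding-cover (δ A))
        (trans (∑-cong U (λ {B} _ → sym (δ-∪ X A B))) (count-avoiding n k (X ∪ A)))
      δΣ = ∑[ A ∈ W ] δ X A * R A
      ιΣ = ∑[ A ∈ W ] ι X A * R A
      complementary : ∀ A → δ X A * R A + ι X A * R A ≡ R A
      complementary A = trans (sym (*-distribʳ-+ (R A) (δ X A) (ι X A)))
        (trans (cong (_* R A) (trans (+-comm (δ X A) _) (ι+δ X A))) (*-identityˡ _))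
      δR : ∀ {A} → A ∈ W → δ X A * e₁ ≡ δ X A * R A
      δR {A} A∈ with disjointᵇ X A in X∩A
      ... | false = refl
      ... | true  = cong (1 *_) (sym (trans (R≡ A) (cong (λ m → (n ∸ m) C k)
                      (trans (∣∪∣-disjoint X A X∩A) (cong (∣ X ∣ +_) (∈ʳ-card A∈))))))
      ιR : ∀ {A} → A ∈ W → ι X A * e₂ ≤ ι X A * R A
      ιR {A} A∈ with disjointᵇ X A in X∩A
      ... | true  = z≤n
      ... | false = *-monoʳ-≤ 1 (≤-trans (C-monoˡ k (∸-monoʳ-≤ n ∣X∪A∣≤)) (≤-reflexive (sym (R≡ A))))
        where
        ∣X∪A∣≤ : ∣ X ∪ A ∣ ≤ ∣ X ∣ + k′
        ∣X∪A∣≤ = ≤-pred (≤-trans (∣∪∣-meeting X A X∩A)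
          (≤-reflexive (trans (cong (∣ X ∣ +_) (trans (∈ʳ-card A∈) k≡)) (+-suc ∣ X ∣ k′))))
      lemma₁ : ∀ a b → a + 2 * b ≡ a + b + b
      lemma₁ = solve-∀

-- Initial segments of the lexicographic order

take-++-≤ : ∀ {s} {xs : List A} ys → s ≤ length xs → take s (xs ++ ys) ≡ take s xs
take-++-≤ {s = zero}                ys _         = refl
take-++-≤ {s = suc s} {xs = x ∷ xs} ys (s≤s s≤) = cong (x ∷_) (take-++-≤ ys s≤)

take-++-≥ : ∀ (xs ys : List A) t → take (length xs + t) (xs ++ ys) ≡ xs ++ take t ys
take-++-≥ []       ys t = refl
take-++-≥ (x ∷ xs) ys t = cong (x ∷_) (take-++-≥ xs ys t)

drop-++-≤ : ∀ {s} {xs : List A} ys → s ≤ length xs → drop s (xs ++ ys) ≡ drop s xs ++ ys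
drop-++-≤ {s = zero}                ys _         = refl
drop-++-≤ {s = suc s} {xs = x ∷ xs} ys (s≤s s≤) = drop-++-≤ ys s≤

drop-++-≥ : ∀ (xs ys : List A) t → drop (length xs + t) (xs ++ ys) ≡ drop t ys
drop-++-≥ []       ys t = refl
drop-++-≥ (x ∷ xs) ys t = drop-++-≥ xs ys t

length-map-kSubsets : ∀ b n k → length (map (b ∷_) (kSubsets n k)) ≡ n C k
length-map-kSubsets b n k = trans (length-map _ (kSubsets n k)) (length-kSubsets n k)

∈-take : ∀ s {xs : List A} {x} → x ∈ take s xs → x ∈ xs
∈-take s {xs} x∈ = subst (_ ∈_) (take++drop≡id s xs) (∈-++⁺ˡ x∈)

∈-drop : ∀ s {xs : List A} {x} → x ∈ drop s xs → x ∈ xs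
∈-drop s {xs} x∈ = subst (_ ∈_) (take++drop≡id s xs) (∈-++⁺ʳ (take s xs) x∈)

L-≤ : ∀ n k {s} → s ≤ n C k → L (suc n) (suc k) s ≡ map (inside ∷_) (L n k s)
L-≤ n k {s} s≤ = trans
  (take-++-≤ _ (≤-trans s≤ (≤-reflexive (sym (length-map-kSubsets inside n k)))))
  (take-map s (kSubsets n k))

L-≥ : ∀ n k t → L (suc n) (suc k) (n C k + t) ≡ map (inside ∷_) (kSubsets n k) ++ map (outside ∷_) (L n (suc k) t)
L-≥ n k t = begin
  take (n C k + t) (in′ ++ out′)       ≡⟨ cong (λ m → take (m + t) (in′ ++ out′)) (sym (length-map-kSubsets inside n k)) ⟩
  take (length in′ + t) (in′ ++ out′)  ≡⟨ take-++-≥ in′ out′ t ⟩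
  in′ ++ take t out′                   ≡⟨ cong (in′ ++_) (take-map t (kSubsets n (suc k))) ⟩
  in′ ++ map (outside ∷_) (L n (suc k) t) ∎
  where
  open ≡-Reasoning
  in′ = map (inside ∷_) (kSubsets n k)
  out′ = map (outside ∷_) (kSubsets n (suc k))

length-L : ∀ n k {s} → s ≤ n C k → length (L n k s) ≡ s
length-L n k {s} s≤ = trans (length-take s (kSubsets n k))
  (m≤n⇒m⊓n≡m (≤-trans s≤ (≤-reflexive (sym (length-kSubsets n k)))))

∈-L : ∀ n k s {A} → A ∈ L n k s → ∣ A ∣ ≡ k
∈-L n k s A∈ = ∈-kSubsets⁻ n k (∈-take s A∈)

2disj-L : ∀ n k s → 2 * disj (L n (suc k) s) ≡ D (L n (suc k) s) (L n (suc k) s)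
2disj-L n k s = 2disj≡D (L n (suc k) s) (λ A∈ → subst (0 <_) (sym (∈-L n (suc k) s A∈)) (s≤s z≤n))

disj-L-star : ∀ n k {s} → s ≤ n C k → disj (L (suc n) (suc k) s) ≡ 0
disj-L-star n k {s} s≤ = m+n≡0⇒m≡0 _ (begin
  2 * disj (L (suc n) (suc k) s)
    ≡⟨ 2disj-L (suc n) k s ⟩
  D (L (suc n) (suc k) s) (L (suc n) (suc k) s)
    ≡⟨ cong (λ F → D F F) (L-≤ n k s≤) ⟩
  D (map (inside ∷_) (L n k s)) (map (inside ∷_) (L n k s))
    ≡⟨ D-map-inside (L n k s) (L n k s) ⟩
  0 ∎)
  where open ≡-Reasoning

-- The first `n C k` sets form the full star of the first point, and each of the other t sets is
-- disjoint from the same number of them. The bound `disj-rest` for an arbitrary family with a full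
-- star has the same shape, so the induction compares only the remainders.
disj-L-suc : ∀ n k {t} → t ≤ n C suc k →
  disj (L (suc n) (suc k) (n C k + t)) ≡ t * ((n ∸ suc k) C k) + disj (L n (suc k) t)
disj-L-suc n k {t} t≤ = *-cancelˡ-≡ _ _ 2 (begin
  2 * disj (L (suc n) (suc k) (n C k + t))
    ≡⟨ 2disj-L (suc n) k (n C k + t) ⟩
  D (L (suc n) (suc k) (n C k + t)) (L (suc n) (suc k) (n C k + t))
    ≡⟨ cong (λ F → D F F) (L-≥ n k t) ⟩
  D (in′ ++ out′) (in′ ++ out′)
    ≡⟨ D-++ in′ out′ ⟩
  D in′ in′ + 2 * D in′ out′ + D out′ out′
    ≡⟨ cong₂ (λ a b → a + 2 * D in′ out′ + b)
         (D-map-inside (kSubsets n k) (kSubsets n k))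
         (D-map-outside (L n (suc k) t) (L n (suc k) t)) ⟩
  2 * D in′ out′ + D (L n (suc k) t) (L n (suc k) t)
    ≡⟨ cong₂ (λ a b → 2 * a + b) cross (sym (2disj-L n k t)) ⟩
  2 * (t * ((n ∸ suc k) C k)) + 2 * disj (L n (suc k) t)
    ≡⟨ sym (*-distribˡ-+ 2 (t * ((n ∸ suc k) C k)) _) ⟩
  2 * (t * ((n ∸ suc k) C k) + disj (L n (suc k) t)) ∎)
  where
  open ≡-Reasoning
  in′ = map (inside ∷_) (kSubsets n k)
  out′ = map (outside ∷_) (L n (suc k) t)
  cross : D in′ out′ ≡ t * ((n ∸ suc k) C k)
  cross = begin
    D in′ out′                             ≡⟨ D-map-inside-outside (kSubsets n k) (L n (suc k) t) ⟩
    D (kSubsets n k) (L n (suc k) t)       ≡⟨ D-sym (kSubsets n k) (L n (suc k) t) ⟩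
    D (L n (suc k) t) (kSubsets n k)       ≡⟨ D-kSubsets k (L n (suc k) t) (∈-L n (suc k) t) ⟩
    length (L n (suc k) t) * ((n ∸ suc k) C k) ≡⟨ cong (_* ((n ∸ suc k) C k)) (length-L n (suc k) t≤) ⟩
    t * ((n ∸ suc k) C k)                  ∎

-- The inductive step of Cauchy-Schwarz for r + 1 summands, a being one of them and b the sum of the
-- others. For positive r it rests on (ra - b)² ≥ 0; for r = 0 the premise forces b = 0.
square-split : ∀ r {a b c} → b * b ≤ r * c → (a + b) * (a + b) ≤ suc r * (a * a + c)
square-split zero {a} {b} {c} h with m*n≡0⇒m≡0∨n≡0 b (n≤0⇒n≡0 h)
... | inj₁ refl = linear (≤-reflexive (lemma a c)) (z≤n {c})
  where
  lemma : ∀ a c → (a + 0) * (a + 0) + c ≡ 1 * (a * a + c) + 0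
  lemma = solve-∀
... | inj₂ refl = linear (≤-reflexive (lemma a c)) (z≤n {c})
  where
  lemma : ∀ a c → (a + 0) * (a + 0) + c ≡ 1 * (a * a + c) + 0
  lemma = solve-∀
square-split r@(suc _) {a} {b} {c} h = *-cancelˡ-≤ r (linear (≤-reflexive (lemma r a b c))
  (+-mono-≤ (2ab≤a²+b² (r * a) b) (*-monoʳ-≤ (suc r) h)))
  where
  lemma : ∀ r a b c → r * ((a + b) * (a + b)) + (r * a * (r * a) + b * b + suc r * (r * c))
                      ≡ r * (suc r * (a * a + c)) + (2 * (r * a) * b + suc r * (b * b))
  lemma = solve-∀

∑meet : List (Subset n) → ℕ
∑meet F = ∑[ A ∈ F ] ∑[ B ∈ F ] ι A B

-- The premise says that the first s sets all meet the first r points. Sorted by their smallest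
-- element they form at most r classes, each pairwise meeting, and Cauchy-Schwarz bounds the sum of
-- the squared class sizes from below by s²/r.
square≤∑meet-L : ∀ r n k s → s + (n ∸ r) C suc k ≤ n C suc k → s * s ≤ r * ∑meet (L n (suc k) s)
square≤∑meet-L zero n k s h
  with refl ← n≤0⇒n≡0 (+-cancelʳ-≤ (n C suc k) s 0 h) = z≤n
square≤∑meet-L (suc r) zero k zero    h = z≤n
square≤∑meet-L (suc r) zero k (suc s) ()
square≤∑meet-L (suc r) (suc n) k s h with ≤-total s (n C k)
... | inj₁ s≤ = begin
  s * s                       ≤⟨ m≤n*m (s * s) (suc r) ⟩
  suc r * (s * s)             ≡⟨ cong (suc r *_) (sym all-meet) ⟩
  suc r * ∑meet (L (suc n) (suc k) s) ∎
  where
  open ≤-Reasoning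
  s≤C : s ≤ suc n C suc k
  s≤C = ≤-trans (m≤m+n s _) h
  all-meet : ∑meet (L (suc n) (suc k) s) ≡ s * s
  all-meet = trans (sym (+-identityʳ _)) (trans
    (cong (∑meet (L (suc n) (suc k) s) +_) (sym (trans (sym (2disj-L (suc n) k s)) (cong (2 *_) (disj-L-star n k s≤)))))
    (trans (∑meet+D (L (suc n) (suc k) s)) (cong (λ m → m * m) (length-L (suc n) (suc k) s≤C))))
... | inj₂ s≥ = begin
  s * s                                      ≡⟨ cong (λ m → m * m) s≡ ⟩
  (N + t) * (N + t)                          ≤⟨ square-split r {N} {t} (square≤∑meet-L r n k t t≤) ⟩
  suc r * (N * N + ∑meet (L n (suc k) t))    ≤⟨ *-monoʳ-≤ (suc r) meet≥ ⟩
  suc r * ∑meet (L (suc n) (suc k) (N + t))  ≡⟨ cong (λ m → suc r * ∑meet (L (suc n) (suc k) m)) (sym s≡) ⟩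
  suc r * ∑meet (L (suc n) (suc k) s)        ∎
  where
  open ≤-Reasoning
  N = n C k
  t = s ∸ N
  s≡ : s ≡ N + t
  s≡ = sym (m+[n∸m]≡n s≥)
  t≤ : t + (n ∸ r) C suc k ≤ n C suc k
  t≤ = +-cancelˡ-≤ N _ _ (begin
    N + (t + (n ∸ r) C suc k)  ≡⟨ sym (+-assoc N t _) ⟩
    N + t + (n ∸ r) C suc k    ≡⟨ cong (_+ (n ∸ r) C suc k) (sym s≡) ⟩
    s + (n ∸ r) C suc k        ≤⟨ h ⟩
    suc n C suc k              ≡⟨ pascal n k ⟩
    N + n C suc k              ∎)
  in′ = map (inside ∷_) (kSubsets n k)
  out′ = map (outside ∷_) (L n (suc k) t)
  meet≥ : N * N + ∑meet (L n (suc k) t) ≤ ∑meet (L (suc n) (suc k) (N + t))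
  meet≥ = begin
    N * N + ∑meet (L n (suc k) t)
      ≡⟨ cong₂ _+_ (sym in-in) (sym out-out) ⟩
    (∑[ A ∈ in′ ] ∑[ B ∈ in′ ] ι A B) + (∑[ A ∈ out′ ] ∑[ B ∈ out′ ] ι A B)
      ≤⟨ +-mono-≤ (∑-mono in′ (λ {A} _ → ≤-trans (m≤m+n _ _) (≤-reflexive (sym (∑-++ in′ out′ (ι A))))))
                  (∑-mono out′ (λ {A} _ → ≤-trans (m≤n+m _ _) (≤-reflexive (sym (∑-++ in′ out′ (ι A)))))) ⟩
    (∑[ A ∈ in′ ] ∑[ B ∈ in′ ++ out′ ] ι A B) + (∑[ A ∈ out′ ] ∑[ B ∈ in′ ++ out′ ] ι A B)
      ≡⟨ sym (∑-++ in′ out′ _) ⟩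
    ∑meet (in′ ++ out′)
      ≡⟨ cong ∑meet (sym (L-≥ n k t)) ⟩
    ∑meet (L (suc n) (suc k) (N + t)) ∎
    where
    U = kSubsets n k
    in-in : (∑[ A ∈ in′ ] ∑[ B ∈ in′ ] ι A B) ≡ N * N
    in-in = trans (∑-map _ U _) (trans (∑-cong U (λ _ → trans (∑-map _ U _) (sym (length-∑ U))))
      (trans (∑-const U (length U)) (cong (λ m → m * m) (length-kSubsets n k))))
    out-out : (∑[ A ∈ out′ ] ∑[ B ∈ out′ ] ι A B) ≡ ∑meet (L n (suc k) t)
    out-out = trans (∑-map _ (L n (suc k) t) _) (∑-cong (L n (suc k) t) (λ _ → ∑-map _ (L n (suc k) t) _))

-- The tail of the lexicographic order consists of the sets that avoid the first r + 1 points
-- and of g sets that meet them only in the last one.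
D-tail≤ : ∀ r n k s g → s + ((n ∸ suc r) C suc k + g) ≡ n C suc k →
  n C suc k ≤ s + (n ∸ r) C suc k →
  D (drop s (kSubsets n (suc k))) (drop s (kSubsets n (suc k)))
    ≤ ((n ∸ suc r) C suc k) * ((n ∸ (suc r + suc k)) C suc k) + 2 * (g * ((n ∸ (suc r + k)) C suc k))
D-tail≤ r zero k zero    g _ _  = z≤n
D-tail≤ r zero k (suc s) g () _
-- The tail starts inside the star of the first point: it consists of the last g sets of that star,
-- which meet pairwise, and of every set outside the star.
D-tail≤ zero (suc n) k s g eq _ = ≤-reflexive (begin
  D (drop s U) (drop s U)
    ≡⟨ cong (λ F → D F F) (trans (drop-++-≤ _ (≤-trans s≤N (≤-reflexive (sym (length-map-kSubsets inside n k)))))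
                                 (cong (_++ out′) (drop-map s (kSubsets n k)))) ⟩
  D (in′ ++ out′) (in′ ++ out′)
    ≡⟨ D-++ in′ out′ ⟩
  D in′ in′ + 2 * D in′ out′ + D out′ out′
    ≡⟨ cong₂ (λ a b → a + 2 * D in′ out′ + b) (D-map-inside (drop s (kSubsets n k)) (drop s (kSubsets n k)))
         (trans (D-map-outside (kSubsets n (suc k)) (kSubsets n (suc k)))
           (trans (D-kSubsets (suc k) (kSubsets n (suc k)) (∈-kSubsets⁻ n (suc k)))
           (cong (_* ((n ∸ suc k) C suc k)) (length-kSubsets n (suc k))))) ⟩
  2 * D in′ out′ + V * e₁
    ≡⟨ cong (λ a → 2 * a + V * e₁) (trans (D-map-inside-outside (drop s (kSubsets n k)) (kSubsets n (suc k)))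
         (trans (D-kSubsets (suc k) (drop s (kSubsets n k)) (λ A∈ → ∈-kSubsets⁻ n k (∈-drop s A∈)))
                (cong (_* ((n ∸ k) C suc k)) length-g))) ⟩
  2 * (g * ((n ∸ k) C suc k)) + V * e₁
    ≡⟨ +-comm (2 * (g * ((n ∸ k) C suc k))) _ ⟩
  V * e₁ + 2 * (g * ((n ∸ k) C suc k)) ∎)
  where
  open ≡-Reasoning
  U = kSubsets (suc n) (suc k)
  in′ = map (inside ∷_) (drop s (kSubsets n k))
  out′ = map (outside ∷_) (kSubsets n (suc k))
  V = n C suc k
  e₁ = (n ∸ suc k) C suc k
  s+g≡N : s + g ≡ n C k
  s+g≡N = +-cancelʳ-≡ V _ _ (trans (lemma s V g) (trans eq (pascal n k)))
    where
    lemma : ∀ s v g → s + g + v ≡ s + (v + g)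
    lemma = solve-∀
  s≤N : s ≤ n C k
  s≤N = ≤-trans (m≤m+n s g) (≤-reflexive s+g≡N)
  length-g : length (drop s (kSubsets n k)) ≡ g
  length-g = trans (length-drop s (kSubsets n k))
    (trans (cong (_∸ s) (trans (length-kSubsets n k) (sym s+g≡N))) (m+n∸m≡n s g))
-- The premise `h` puts the whole star of the first point into the initial segment, so the tail
-- lives on the other n points.
D-tail≤ (suc r) (suc n) k s g eq h = ≤-trans (≤-reflexive (begin
  D (drop s U) (drop s U)
    ≡⟨ cong (λ F → D F F) (trans (cong (λ m → drop m U) (trans s≡ (cong (_+ t) (sym (length-map-kSubsets inside n k)))))
         (trans (drop-++-≥ (map (inside ∷_) (kSubsets n k)) _ t) (drop-map t (kSubsets n (suc k))))) ⟩
  D (map (outside ∷_) (drop t (kSubsets n (suc k)))) (map (outside ∷_) (drop t (kSubsets n (suc k))))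
    ≡⟨ D-map-outside (drop t (kSubsets n (suc k))) (drop t (kSubsets n (suc k))) ⟩
  D (drop t (kSubsets n (suc k))) (drop t (kSubsets n (suc k))) ∎))
  (D-tail≤ r n k t g (+-cancelˡ-≡ N _ _ (begin
    N + (t + ((n ∸ suc r) C suc k + g))  ≡⟨ sym (+-assoc N t _) ⟩
    N + t + ((n ∸ suc r) C suc k + g)    ≡⟨ cong (_+ ((n ∸ suc r) C suc k + g)) (sym s≡) ⟩
    s + ((n ∸ suc r) C suc k + g)        ≡⟨ eq ⟩
    suc n C suc k                        ≡⟨ pascal n k ⟩
    N + n C suc k                        ∎))
    (+-cancelˡ-≤ N _ _ (≤-trans (≤-reflexive (sym (pascal n k))) (≤-trans h (≤-reflexive
      (trans (cong (_+ (n ∸ r) C suc k) s≡) (+-assoc N t _)))))))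
  where
  open ≡-Reasoning
  U = kSubsets (suc n) (suc k)
  N = n C k
  s≥N : N ≤ s
  s≥N = +-cancelʳ-≤ (n C suc k) N s (≤-trans (≤-reflexive (sym (pascal n k)))
    (≤-trans h (+-monoʳ-≤ s (C-monoˡ (suc k) (m∸n≤m n r)))))
  t = s ∸ N
  s≡ : s ≡ N + t
  s≡ = sym (m+[n∸m]≡n s≥N)

-- Both families have s members, so `D-complement` reduces the claim to their missing sets. The
-- number g of missing sets that meet the cover is the same on both sides, since both covers have r
-- + 1 points; the upper bound for the tail then equals the lower bound for `W`.
covered-disj : ∀ {r n k} {F W : List (Subset n)} → kSubsets n (suc k) ↭ F ++ W → ∀ {X} →
  (∀ {A} → A ∈ F → disjointᵇ X A ≡ false) → ∣ X ∣ ≡ suc r →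
  n C suc k ≤ length F + (n ∸ r) C suc k → disj (L n (suc k) (length F)) ≤ disj F
covered-disj {r} {n} {k} {F} {W} U↭ {X} covers ∣X∣≡ h =
  *-cancelˡ-≤ 2 (≤-trans (≤-reflexive (2disj-L n k s)) (≤-trans D≤ (≤-reflexive (sym
    (2disj≡D F (λ A∈ → subst (0 <_) (sym (∈ˡ-card F W U↭ A∈)) (s≤s z≤n)))))))
  where
  s = length F
  c = (n ∸ suc k) C suc k
  W′ = drop s (kSubsets n (suc k))
  U↭′ : kSubsets n (suc k) ↭ L n (suc k) s ++ W′
  U↭′ = ↭-reflexive (sym (take++drop≡id s (kSubsets n (suc k))))
  s≤ : s ≤ n C suc k
  s≤ = ≤-trans (m≤m+n s _) (≤-reflexive (length-split F W U↭))
  length-W′ : length W′ ≡ length W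
  length-W′ = +-cancelˡ-≡ s _ _ (trans (cong (_+ length W′) (sym (length-L n (suc k) s≤)))
    (trans (length-split (L n (suc k) s) W′ U↭′) (sym (length-split F W U↭))))
  D-W≤ : D W′ W′ ≤ D W W
  D-W≤ = ≤-trans (D-tail≤ r n k s (∑ W (ι X))
      (trans (cong (s +_) (subst (λ m → (n ∸ m) C suc k + ∑ W (ι X) ≡ length W) ∣X∣≡ (length-complement F W U↭ X covers)))
             (length-split F W U↭)) h)
    (≤-trans (≤-reflexive (cong (λ m → ((n ∸ m) C suc k) * ((n ∸ (m + suc k)) C suc k)
                                        + 2 * (∑ W (ι X) * ((n ∸ (m + k)) C suc k))) (sym ∣X∣≡)))
             (D-complement≥ F W U↭ X covers refl))
  D≤ : D (L n (suc k) s) (L n (suc k) s) ≤ D F F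
  D≤ = +-cancelʳ-≤ (length W * c) _ _ (begin
    D (L n (suc k) s) (L n (suc k) s) + length W * c   ≡⟨ cong (λ m → D (L n (suc k) s) (L n (suc k) s) + m * c) (sym length-W′) ⟩
    D (L n (suc k) s) (L n (suc k) s) + length W′ * c  ≡⟨ D-complement (L n (suc k) s) W′ U↭′ ⟩
    length (L n (suc k) s) * c + D W′ W′               ≡⟨ cong (λ m → m * c + D W′ W′) (length-L n (suc k) s≤) ⟩
    s * c + D W′ W′                                    ≤⟨ +-monoʳ-≤ (s * c) D-W≤ ⟩
    s * c + D W W                                      ≡⟨ sym (D-complement F W U↭) ⟩
    D F F + length W * c                               ∎)
    where open ≤-Reasoning

-- Numerical consequences of the size of n

-- C(n, k - 1), the number of (k + 1)-sets through two given points among n + 2. The case k = 0 is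
-- separate because `n C (k ∸ 1)` would give 1 there, where the count is 0.
pairs : ℕ → ℕ → ℕ
pairs n zero    = 0
pairs n (suc k) = n C k

pairs-pascal : ∀ n k → pairs n k + n C k ≡ suc n C k
pairs-pascal n zero    = refl
pairs-pascal n (suc k) = sym (pascal n k)

pairs-mono : ∀ k {m n} → m ≤ n → pairs m k ≤ pairs n k
pairs-mono zero    m≤n = z≤n
pairs-mono (suc k) m≤n = C-monoˡ k m≤n

-- By absorption, n + 1 copies of C(n, k - 1) make k stars of size C(n + 1, k), and one more copy
-- fits into a further star. This is how a large n makes codegrees small compared with stars.
n*pairs≤k*star : ∀ n k → suc (suc n) * pairs n k ≤ suc k * (suc n C k)
n*pairs≤k*star n zero    = ≤-trans (≤-reflexive (*-zeroʳ (suc (suc n)))) z≤n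
n*pairs≤k*star n (suc k) = +-mono-≤ (C-monoˡ′ n k) (≤-reflexive (sym (absorption n k)))
  where
  C-monoˡ′ : ∀ n k → n C k ≤ suc n C suc k
  C-monoˡ′ n k = ≤-trans (m≤m+n _ _) (≤-reflexive (sym (pascal n k)))

-- By Pascal's rule, deleting one more point of the ground set costs a star at most `pairs n k`
-- sets.
star≤ : ∀ n k j → suc n C k ≤ ((suc n ∸ j) C k) + j * pairs n k
star≤ n k zero    = ≤-reflexive (sym (+-identityʳ _))
star≤ n k (suc j) = ≤-trans (star≤ n k j) (≤-trans (+-monoˡ-≤ (j * pairs n k) (step j))
  (≤-reflexive (+-assoc ((suc n ∸ suc j) C k) (pairs n k) (j * pairs n k))))
  where
  step : ∀ j → (suc n ∸ j) C k ≤ ((suc n ∸ suc j) C k) + pairs n k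
  step j with ≤-total j n
  ... | inj₁ j≤n = begin
    (suc n ∸ j) C k                      ≡⟨ cong (_C k) (+-∸-assoc 1 j≤n) ⟩
    suc (n ∸ j) C k                      ≡⟨ sym (pairs-pascal (n ∸ j) k) ⟩
    pairs (n ∸ j) k + ((n ∸ j) C k)      ≤⟨ +-monoˡ-≤ _ (pairs-mono k (m∸n≤m n j)) ⟩
    pairs n k + ((n ∸ j) C k)            ≡⟨ +-comm (pairs n k) _ ⟩
    ((n ∸ j) C k) + pairs n k            ∎
    where open ≤-Reasoning
  ... | inj₂ n≤j = begin
    (suc n ∸ j) C k                      ≤⟨ C-monoˡ k lemma ⟩
    1 C k                                ≡⟨ sym (pairs-pascal 0 k) ⟩
    pairs 0 k + (0 C k)                  ≤⟨ +-mono-≤ (pairs-mono k z≤n) (≤-reflexive (cong (_C k) (sym (m≤n⇒m∸n≡0 n≤j)))) ⟩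
    pairs n k + ((n ∸ j) C k)            ≡⟨ +-comm (pairs n k) _ ⟩
    ((n ∸ j) C k) + pairs n k            ∎
    where
    open ≤-Reasoning
    lemma : suc n ∸ j ≤ 1
    lemma = m≤n+o⇒m∸n≤o (suc n) j (≤-trans (s≤s n≤j) (≤-reflexive (sym (+-comm j 1))))

-- The ground set has n + 2 points, the sets have K = k + 1 elements, and ℓ is R = r + 2. The
-- premise `s>` says that s exceeds the number of k-sets meeting ℓ - 1 given points.
module Sizes {n k r s : ℕ}
  (large : 108 * (suc k * suc k) * suc (suc r) * (suc k + suc (suc r)) < suc (suc n))
  (s> : suc (suc n) C suc k < s + (suc n ∸ r) C suc k)
  where

  private
    N q K R : ℕ
    N = suc n C k
    q = pairs n k
    K = suc k
    R = suc (suc r)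

  2Rq≤N : 2 * (R * q) ≤ N
  2Rq≤N = *-cancelˡ-≤ K (≤-trans (≤-reflexive (lemma K R q))
    (≤-trans (*-monoˡ-≤ q (≤-trans small (<⇒≤ large))) (n*pairs≤k*star n k)))
    where
    lemma : ∀ K R q → K * (2 * (R * q)) ≡ 2 * K * R * q
    lemma = solve-∀
    lemma′ : ∀ K R → 108 * (K * K) * R * (K + R) ≡ 2 * K * R * (54 * (K * (K + R)))
    lemma′ = solve-∀
    small : 2 * K * R ≤ 108 * (K * K) * R * (K + R)
    small = ≤-trans (m≤m*n (2 * K * R) (54 * (K * (K + R)))) (≤-reflexive (sym (lemma′ K R)))

  r≤n : r ≤ n
  r≤n = ≤-pred (≤-pred (≤-trans (≤-trans (m≤n*m R (108 * (K * K))) (m≤m*n _ (K + R))) (<⇒≤ large)))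

  -- The sets meeting i + 1 given points number at least (i + 2)N/2: the first star has N sets, and
  -- each further one has lost at most Rq ≤ N/2 of its sets to the earlier stars.
  stars≤ : ∀ i → i ≤ r → suc (suc i) * N + 2 * ((suc n ∸ i) C K) ≤ 2 * (suc (suc n) C K)
  stars≤ zero    _   = ≤-reflexive (trans (lemma N (suc n C K)) (cong (2 *_) (sym (pascal (suc n) k))))
    where
    lemma : ∀ a b → 2 * a + 2 * b ≡ 2 * (a + b)
    lemma = solve-∀
  stars≤ (suc i) i<r = begin
    suc (suc (suc i)) * N + 2 * (t C K)
      ≡⟨ lemma₁ i N (t C K) ⟩
    suc (suc i) * N + (N + 2 * (t C K))
      ≤⟨ +-monoʳ-≤ (suc (suc i) * N) (+-monoˡ-≤ (2 * (t C K)) N≤2tCk) ⟩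
    suc (suc i) * N + (2 * (t C k) + 2 * (t C K))
      ≡⟨ cong (suc (suc i) * N +_) (trans (sym (*-distribˡ-+ 2 (t C k) (t C K))) (cong (2 *_) (sym (pascal t k)))) ⟩
    suc (suc i) * N + 2 * (suc t C K)
      ≡⟨ cong (λ m → suc (suc i) * N + 2 * (m C K)) (sym (+-∸-assoc 1 i≤n)) ⟩
    suc (suc i) * N + 2 * ((suc n ∸ i) C K)
      ≤⟨ stars≤ i (<⇒≤ i<r) ⟩
    2 * (suc (suc n) C K) ∎
    where
    open ≤-Reasoning
    t = n ∸ i
    i≤n : i ≤ n
    i≤n = ≤-trans (<⇒≤ i<r) r≤n
    lemma₁ : ∀ i N a → suc (suc (suc i)) * N + 2 * a ≡ suc (suc i) * N + (N + 2 * a)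
    lemma₁ = solve-∀
    lemma₂ : ∀ N a b → N + (2 * (a + b) + N) ≡ 2 * a + (2 * N + 2 * b)
    lemma₂ = solve-∀
    N≤2tCk : N ≤ 2 * (t C k)
    N≤2tCk = linear (≤-reflexive (lemma₂ N (t C k) (suc i * q)))
      (+-mono-≤ (*-monoʳ-≤ 2 (star≤ n k (suc i)))
        (≤-trans (*-monoʳ-≤ 2 (*-monoˡ-≤ q (≤-trans i<r (≤-trans (n≤1+n r) (n≤1+n (suc r)))))) 2Rq≤N))

  RN≤2s : R * N ≤ 2 * s
  RN≤2s = +-cancelʳ-≤ (2 * ((suc n ∸ r) C K)) _ _ (≤-trans (stars≤ r ≤-refl)
    (≤-trans (*-monoʳ-≤ 2 (<⇒≤ s>)) (≤-reflexive (*-distribˡ-+ 2 s _))))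

  -- The one use of the full strength of the hypothesis on n. Of 108 = 2 * 54, the factor 2 is spent
  -- on `RN≤2s`.
  codegree-bound : 54 * (R * R * K * q * (K + R)) ≤ s
  codegree-bound = *-cancelˡ-≤ (2 * K) (begin
    2 * K * (54 * (R * R * K * q * (K + R)))    ≡⟨ lemma₁ K R q ⟩
    108 * (K * K) * R * (K + R) * (R * q)       ≤⟨ *-monoˡ-≤ (R * q) (<⇒≤ large) ⟩
    suc (suc n) * (R * q)                       ≡⟨ lemma₂ (suc (suc n)) R q ⟩
    R * (suc (suc n) * q)                       ≤⟨ *-monoʳ-≤ R (n*pairs≤k*star n k) ⟩
    R * (K * N)                                 ≡⟨ lemma₃ R K N ⟩
    K * (R * N)                                 ≤⟨ *-monoʳ-≤ K RN≤2s ⟩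
    K * (2 * s)                                 ≡⟨ lemma₄ K s ⟩
    2 * K * s                                   ∎)
    where
    open ≤-Reasoning
    lemma₁ : ∀ K R q → 2 * K * (54 * (R * R * K * q * (K + R))) ≡ 108 * (K * K) * R * (K + R) * (R * q)
    lemma₁ = solve-∀
    lemma₂ : ∀ n R q → n * (R * q) ≡ R * (n * q)
    lemma₂ = solve-∀
    lemma₃ : ∀ R K N → R * (K * N) ≡ K * (R * N)
    lemma₃ = solve-∀
    lemma₄ : ∀ K s → K * (2 * s) ≡ 2 * K * s
    lemma₄ = solve-∀

-- Removing a full star

T-not : ∀ {b} → T (not b) → b ≡ false
T-not {false} _ = refl

∣removeAt∣ : ∀ (x : Fin (suc n)) A → lookup A x ≡ false → ∣ removeAt A x ∣ ≡ ∣ A ∣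
∣removeAt∣ zero    (false ∷ A)             _ = refl
∣removeAt∣ (suc x) (true  ∷ A@(_ ∷ _)) h = cong suc (∣removeAt∣ x A h)
∣removeAt∣ (suc x) (false ∷ A@(_ ∷ _)) h = ∣removeAt∣ x A h

disjointᵇ-removeAt : ∀ (x : Fin (suc n)) A B → lookup A x ≡ false →
  disjointᵇ (removeAt A x) (removeAt B x) ≡ disjointᵇ A B
disjointᵇ-removeAt zero    (false ∷ A)         (_ ∷ B)         _ = refl
disjointᵇ-removeAt (suc x) (a ∷ A@(_ ∷ _)) (b ∷ B@(_ ∷ _)) h = cong (not (a ∧ b) ∧_) (disjointᵇ-removeAt x A B h)

removeAt-injective : ∀ (x : Fin (suc n)) A B → lookup A x ≡ false → lookup B x ≡ false →
  removeAt A x ≡ removeAt B x → A ≡ B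
removeAt-injective x A B hA hB eq = begin
  A                                    ≡⟨ sym (insertAt-removeAt A x) ⟩
  insertAt (removeAt A x) x (lookup A x) ≡⟨ cong₂ (λ v b → insertAt v x b) eq (trans hA (sym hB)) ⟩
  insertAt (removeAt B x) x (lookup B x) ≡⟨ insertAt-removeAt B x ⟩
  B                                    ∎
  where
  open ≡-Reasoning

map-unique : ∀ {A B : Set} (f : A → B) {xs} → (∀ {x y} → x ∈ xs → y ∈ xs → f x ≡ f y → x ≡ y) →
  Unique xs → Unique (map f xs)
map-unique f inj []        = []
map-unique f inj (x∉ ∷ u) =
  All.tabulate (λ fy∈ → apart (∈-map⁻ f fy∈)) ∷ map-unique f (λ x∈ y∈ → inj (there x∈) (there y∈)) u
  where
  apart : ∀ {z} → (∃ λ y → y ∈ _ × z ≡ f y) → f _ ≢ z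
  apart (y , y∈ , refl) eq = All.lookup x∉ y∈ (inj (here refl) (there y∈) eq)

-- By `full`, no missing set contains x, so `F` contains the whole star of x. The members avoiding
-- x, with coordinate x deleted, form a family `rest` on m points, ready for the induction
-- hypothesis.
module FullStar {m k} (F W : List (Subset (suc m))) (U↭ : kSubsets (suc m) (suc k) ↭ F ++ W)
                (x : Fin (suc m)) (full : ∑ W (mem x) ≡ 0) (k<m : suc k ≤ m) where

  private
    U = kSubsets (suc m) (suc k)
    c : ℕ
    c = (m ∸ suc k) C k
    out : Subset (suc m) → ℕ
    out A = ⟦ not (lookup A x) ⟧
    out? = λ (A : Subset (suc m)) → T? (not (lookup A x))
    F₀ = filter out? F

  rest : List (Subset m)
  rest = map (λ A → removeAt A x) F₀

  private
    F₀-out : ∀ {A} → A ∈ F₀ → lookup A x ≡ false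
    F₀-out A∈ = T-not (proj₂ (∈-filter⁻ out? {xs = F} A∈))

    F₀-card : ∀ {A} → A ∈ F₀ → ∣ A ∣ ≡ suc k
    F₀-card A∈ = ∈ˡ-card F W U↭ (proj₁ (∈-filter⁻ out? {xs = F} A∈))

    ∑-star : ∀ (f : Subset (suc m) → ℕ) → (∑[ A ∈ F ] mem x A * f A) ≡ (∑[ A ∈ U ] mem x A * f A)
    ∑-star f = sym (trans (∑-split {k = suc k} F W U↭ _) (trans (cong ((∑[ A ∈ F ] mem x A * f A) +_) none) (+-identityʳ _)))
      where
      none : (∑[ A ∈ W ] mem x A * f A) ≡ 0
      none = trans (∑-cong W (λ {A} A∈ → cong (_* f A) (n≤0⇒n≡0 (≤-trans (∑-∈ (mem x) A∈) (≤-reflexive full)))))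
                   (trans (∑-const W 0) (*-zeroʳ (length W)))

    ∑-in-out : ∀ (f : Subset (suc m) → ℕ) → ∑ F f ≡ (∑[ A ∈ F ] mem x A * f A) + (∑[ A ∈ F₀ ] f A)
    ∑-in-out f = begin
      ∑ F f
        ≡⟨ ∑-cong F (λ {A} _ → trans (sym (*-identityˡ (f A))) (trans (cong (_* f A)
             (sym (trans (+-comm (mem x A) _) (⟦not⟧ (lookup A x))))) (*-distribʳ-+ (f A) (mem x A) (out A)))) ⟩
      (∑[ A ∈ F ] mem x A * f A + out A * f A)
        ≡⟨ ∑-+ F _ _ ⟩
      (∑[ A ∈ F ] mem x A * f A) + (∑[ A ∈ F ] out A * f A)
        ≡⟨ cong ((∑[ A ∈ F ] mem x A * f A) +_) (sym (∑-filter out? F f)) ⟩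
      (∑[ A ∈ F ] mem x A * f A) + (∑[ A ∈ F₀ ] f A) ∎
      where open ≡-Reasoning

    -- The sets through x disjoint from A are those disjoint from A without those disjoint from
    -- `⁅ x ⁆ ∪ A`; Pascal's rule evaluates the difference.
    star-avoiding : ∀ {A} → A ∈ F₀ → (∑[ B ∈ F ] mem x B * δ A B) ≡ c
    star-avoiding {A} A∈ = trans (∑-star (δ A)) (+-cancelʳ-≡ ((m ∸ suc k) C suc k) _ _ (begin
      (∑[ B ∈ U ] mem x B * δ A B) + (m ∸ suc k) C suc k
        ≡⟨ cong ((∑[ B ∈ U ] mem x B * δ A B) +_) (sym (trans (count-avoiding (suc m) (suc k) (⁅ x ⁆ ∪ A))
             (cong (λ j → (suc m ∸ j) C suc k) ∣x∪A∣))) ⟩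
      (∑[ B ∈ U ] mem x B * δ A B) + (∑[ B ∈ U ] δ (⁅ x ⁆ ∪ A) B)
        ≡⟨ sym (∑-+ U _ _) ⟩
      (∑[ B ∈ U ] mem x B * δ A B + δ (⁅ x ⁆ ∪ A) B)
        ≡⟨ ∑-cong U (λ {B} _ → trans (cong (mem x B * δ A B +_) (δ-∪ ⁅ x ⁆ A B))
             (trans (sym (*-distribʳ-+ (δ A B) (mem x B) (δ ⁅ x ⁆ B)))
                    (trans (cong (_* δ A B) (δ-⁅⁆ x B)) (*-identityˡ _)))) ⟩
      (∑[ B ∈ U ] δ A B)
        ≡⟨ trans (count-avoiding (suc m) (suc k) A) (cong (λ j → (suc m ∸ j) C suc k) (F₀-card A∈)) ⟩
      (m ∸ k) C suc k
        ≡⟨ cong (_C suc k) (+-∸-assoc 1 k<m) ⟩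
      suc (m ∸ suc k) C suc k
        ≡⟨ pascal (m ∸ suc k) k ⟩
      c + (m ∸ suc k) C suc k ∎))
      where
      open ≡-Reasoning
      ∣x∪A∣ : ∣ ⁅ x ⁆ ∪ A ∣ ≡ suc (suc k)
      ∣x∪A∣ = trans (∣∪∣-disjoint ⁅ x ⁆ A (trans (disjointᵇ-⁅⁆ x A) (cong not (F₀-out A∈))))
                    (cong₂ _+_ (∣⁅x⁆∣≡1 x) (F₀-card A∈))

    D-F≥ : 2 * (length F₀ * c) + D F₀ F₀ ≤ D F F
    D-F≥ = begin
      2 * (length F₀ * c) + D F₀ F₀
        ≡⟨ lemma (length F₀ * c) (D F₀ F₀) ⟩
      length F₀ * c + (length F₀ * c + D F₀ F₀)
        ≡⟨ cong (λ t → t + (t + D F₀ F₀)) (sym (trans (∑-cong F₀ star-avoiding) (∑-const F₀ c))) ⟩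
      S + (S + D F₀ F₀)
        ≡⟨ cong (S +_) (trans (sym (∑-+ F₀ _ _)) (∑-cong F₀ (λ {A} _ → sym (∑-in-out (δ A))))) ⟩
      S + (∑[ A ∈ F₀ ] avoid F A)
        ≡⟨ cong (_+ (∑[ A ∈ F₀ ] avoid F A)) swap ⟩
      (∑[ B ∈ F ] mem x B * avoid F₀ B) + (∑[ A ∈ F₀ ] avoid F A)
        ≤⟨ +-monoˡ-≤ _ (∑-mono F (λ {B} _ → *-monoʳ-≤ (mem x B)
             (≤-trans (m≤n+m _ (∑[ A ∈ F ] mem x A * δ B A)) (≤-reflexive (sym (∑-in-out (δ B))))))) ⟩
      (∑[ B ∈ F ] mem x B * avoid F B) + (∑[ A ∈ F₀ ] avoid F A)
        ≡⟨ sym (∑-in-out (avoid F)) ⟩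
      D F F ∎
      where
      open ≤-Reasoning
      S = ∑[ A ∈ F₀ ] ∑[ B ∈ F ] mem x B * δ A B
      swap : S ≡ (∑[ B ∈ F ] mem x B * avoid F₀ B)
      swap = trans (∑-swap F₀ F _) (∑-cong F (λ {B} _ →
        trans (∑-*ˡ F₀ (mem x B) (λ A → δ A B)) (cong (mem x B *_) (∑-cong F₀ (λ {A} _ → δ-sym A B)))))
      lemma : ∀ a b → 2 * a + b ≡ a + (a + b)
      lemma = solve-∀

  rest-card : ∀ {A} → A ∈ rest → ∣ A ∣ ≡ suc k
  rest-card A∈ with B , B∈ , refl ← ∈-map⁻ (λ A → removeAt A x) A∈ = trans (∣removeAt∣ x B (F₀-out B∈)) (F₀-card B∈)

  rest-unique : Unique F → Unique rest
  rest-unique u = map-unique (λ A → removeAt A x)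
    (λ {A} {B} A∈ B∈ → removeAt-injective x A B (F₀-out A∈) (F₀-out B∈)) (Unique.filter⁺ out? u)

  rest-length : m C k + length rest ≡ length F
  rest-length = begin
    m C k + length rest
      ≡⟨ cong₂ _+_ (sym (count-star m k x)) (trans (length-map _ F₀) (length-∑ F₀)) ⟩
    (∑[ A ∈ U ] mem x A) + (∑[ _ ∈ F₀ ] 1)
      ≡⟨ cong (_+ (∑[ _ ∈ F₀ ] 1)) (trans (∑-cong U (λ _ → sym (*-identityʳ _))) (sym (∑-star (λ _ → 1)))) ⟩
    (∑[ A ∈ F ] mem x A * 1) + (∑[ _ ∈ F₀ ] 1)
      ≡⟨ sym (∑-in-out (λ _ → 1)) ⟩
    (∑[ _ ∈ F ] 1)
      ≡⟨ sym (length-∑ F) ⟩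
    length F ∎
    where open ≡-Reasoning

  disj-rest : length rest * c + disj rest ≤ disj F
  disj-rest = *-cancelˡ-≤ 2 (begin
    2 * (length rest * c + disj rest)      ≡⟨ *-distribˡ-+ 2 (length rest * c) (disj rest) ⟩
    2 * (length rest * c) + 2 * disj rest  ≡⟨ cong₂ (λ l t → 2 * (l * c) + t) (length-map _ F₀) (trans 2disj-rest D-rest) ⟩
    2 * (length F₀ * c) + D F₀ F₀          ≤⟨ D-F≥ ⟩
    D F F                                  ≡⟨ sym (2disj≡D F (λ A∈ → subst (0 <_) (sym (∈ˡ-card F W U↭ A∈)) (s≤s z≤n))) ⟩
    2 * disj F                             ∎)
    where
    open ≤-Reasoning
    2disj-rest : 2 * disj rest ≡ D rest rest
    2disj-rest = 2disj≡D rest (λ A∈ → subst (0 <_) (sym (rest-card A∈)) (s≤s z≤n))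
    D-rest : D rest rest ≡ D F₀ F₀
    D-rest = trans (∑-map _ F₀ _) (∑-cong F₀ (λ {A} A∈ → trans (∑-map _ F₀ _)
      (∑-cong F₀ (λ {B} _ → cong ⟦_⟧ (disjointᵇ-removeAt x A B (F₀-out A∈))))))

-- The induction

++-apart : ∀ {A : Set} {xs ys : List A} {x} → Unique (xs ++ ys) → x ∈ ys → x ∉ xs
++-apart {xs = y ∷ xs} (y∉ ∷ u) x∈ys (here refl)  = All.lookup y∉ (∈-++⁺ʳ xs x∈ys) refl
++-apart {xs = y ∷ xs} (y∉ ∷ u) x∈ys (there x∈xs) = ++-apart u x∈ys x∈xs

disj-↭ : ∀ {F G : List (Subset n)} → (∀ {A} → A ∈ F → 0 < ∣ A ∣) → F ↭ G → disj F ≡ disj G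
disj-↭ {F = F} {G} nonempty p = *-cancelˡ-≡ _ _ 2 (begin
  2 * disj F  ≡⟨ 2disj≡D F nonempty ⟩
  D F F       ≡⟨ D-↭ p ⟩
  D G G       ≡⟨ sym (2disj≡D G (λ A∈ → nonempty (∈-resp-↭ (↭-sym p) A∈))) ⟩
  2 * disj G  ∎)
  where open ≡-Reasoning

-- `crowded` says that A meets fewer than deg x members, itself included. Removing A lowers the
-- degree of x by at most one, but it also removes A from the members that A meets. So among `F₀`
-- the set A still meets fewer members than contain x, and B meets all of those.
swap-disj : ∀ {F F₀ : List (Subset n)} {A B x} → F ↭ A ∷ F₀ → (∀ {E} → E ∈ F → 0 < ∣ E ∣) → mem x B ≡ 1 →
  length F < avoid F A + (∑[ E ∈ F ] mem x E) → disj (B ∷ F₀) < disj F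
swap-disj {F = F} {F₀} {A} {B} {x} F↭ nonempty x∈B crowded = begin-strict
  disj (B ∷ F₀)           ≡⟨ disj-∷ B F₀ ⟩
  avoid F₀ B + disj F₀    <⟨ +-monoˡ-< (disj F₀) fewer ⟩
  avoid F₀ A + disj F₀    ≡⟨ sym (disj-∷ A F₀) ⟩
  disj (A ∷ F₀)           ≡⟨ sym (disj-↭ nonempty F↭) ⟩
  disj F                  ∎
  where
  open ≤-Reasoning
  d₀ = ∑[ E ∈ F₀ ] mem x E
  avoid-B : avoid F₀ B + d₀ ≤ length F₀
  avoid-B = begin
    avoid F₀ B + d₀                      ≤⟨ +-monoʳ-≤ (avoid F₀ B) (∑-mono F₀ meets) ⟩
    avoid F₀ B + (∑[ E ∈ F₀ ] ι B E)     ≡⟨ +-comm (avoid F₀ B) _ ⟩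
    (∑[ E ∈ F₀ ] ι B E) + avoid F₀ B     ≡⟨ meet+avoid F₀ B ⟩
    length F₀                            ∎
    where
    meets : ∀ {E} → E ∈ F₀ → mem x E ≤ ι B E
    meets {E} _ = ≤-trans (≤-reflexive (trans (sym (*-identityˡ _)) (cong (_* mem x E) (sym x∈B)))) (mem*mem≤ι x B E)
  fewer : avoid F₀ B < avoid F₀ A
  fewer = +-cancelʳ-< (suc d₀) _ _ (begin-strict
    avoid F₀ B + suc d₀
      ≡⟨ +-suc (avoid F₀ B) d₀ ⟩
    suc (avoid F₀ B + d₀)
      ≤⟨ s≤s avoid-B ⟩
    suc (length F₀)
      ≡⟨ sym (↭-length F↭) ⟩
    length F
      <⟨ crowded ⟩
    avoid F A + (∑[ E ∈ F ] mem x E)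
      ≡⟨ cong₂ _+_ (∑-↭ (δ A) F↭) (∑-↭ (mem x) F↭) ⟩
    δ A A + avoid F₀ A + (mem x A + d₀)
      ≤⟨ +-mono-≤ (≤-reflexive (cong (_+ avoid F₀ A) (δ-self A (nonempty (∈-resp-↭ (↭-sym F↭) (here refl))))))
                  (+-monoˡ-≤ d₀ (⟦⟧≤1 (lookup A x))) ⟩
    avoid F₀ A + suc d₀ ∎)

codeg≤pairs : ∀ {n k} {F W : List (Subset (suc (suc n)))} → kSubsets (suc (suc n)) (suc k) ↭ F ++ W →
  ∀ {x y} → x ≢ y → (∑[ A ∈ F ] mem x A * mem y A) ≤ pairs n k
codeg≤pairs {n} {k} {F} {W} U↭ x≢y = ≤-trans (m≤m+n _ _) (≤-reflexive (trans (sym (∑-split {k = suc k} F W U↭ _))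
  (+-cancelʳ-≡ (n C k) _ _ (trans (count-pair n k x≢y) (sym (pairs-pascal n k))))))

Minimal : ℕ → ℕ → ℕ → Set
Minimal k ℓ n = ∀ (F : List (Subset n)) → Unique F → (∀ {A} → A ∈ F → ∣ A ∣ ≡ suc k) →
  length F + (n ∸ ℓ) C suc k ≤ n C suc k → disj (L n (suc k) (length F)) ≤ disj F

max-value : ∀ n (f : Fin (suc n) → ℕ) → ∃ λ x → ∀ y → f y ≤ f x
max-value n f = argmax f zero (allFin (suc n)) ,
  λ y → All.lookup (f[xs]≤f[argmax] {f = f} zero (allFin (suc n))) (∈-allFin y)

-- The case ℓ = r + 2 on n + 2 points; `minimal` is the induction hypothesis for ℓ - 1 on one point
-- fewer, as needed after a centre is deleted.
module Step {n k r : ℕ} (large : 108 * (suc k * suc k) * suc (suc r) * (suc k + suc (suc r)) < suc (suc n))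
            (minimal : Minimal k (suc r) (suc n)) where

  private
    N U : _
    N = suc n C k
    U = kSubsets (suc (suc n)) (suc k)

  k<n : suc k ≤ suc n
  k<n = ≤-pred (≤-trans (s≤s (≤-trans (m≤n*m (suc k) (108 * suc k))
    (≤-trans (≤-reflexive (*-assoc 108 (suc k) (suc k)))
      (≤-trans (m≤m*n (108 * (suc k * suc k)) (suc (suc r))) (m≤m*n _ (suc k + suc (suc r))))))) large)

  full-star : ∀ {F W} (U↭ : U ↭ F ++ W) {x} → ∑ W (mem x) ≡ 0 → Unique F →
    length F + (n ∸ r) C suc k ≤ suc (suc n) C suc k → disj (L (suc (suc n)) (suc k) (length F)) ≤ disj F
  full-star {F} {W} U↭ {x} full u h = begin
    disj (L (suc (suc n)) (suc k) (length F))
      ≡⟨ cong (λ m → disj (L (suc (suc n)) (suc k) m)) (sym rest-length) ⟩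
    disj (L (suc (suc n)) (suc k) (N + length rest))
      ≡⟨ disj-L-suc (suc n) k (≤-trans (m≤m+n _ _) h′) ⟩
    length rest * ((suc n ∸ suc k) C k) + disj (L (suc n) (suc k) (length rest))
      ≤⟨ +-monoʳ-≤ _ (minimal rest (rest-unique u) rest-card h′) ⟩
    length rest * ((suc n ∸ suc k) C k) + disj rest
      ≤⟨ disj-rest ⟩
    disj F ∎
    where
    open ≤-Reasoning
    open FullStar F W U↭ x full k<n
    h′ : length rest + (n ∸ r) C suc k ≤ suc n C suc k
    h′ = +-cancelˡ-≤ N _ _ (begin
      N + (length rest + (n ∸ r) C suc k)  ≡⟨ sym (+-assoc N (length rest) _) ⟩
      N + length rest + (n ∸ r) C suc k    ≡⟨ cong (_+ (n ∸ r) C suc k) rest-length ⟩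
      length F + (n ∸ r) C suc k           ≤⟨ h ⟩
      suc (suc n) C suc k                  ≡⟨ pascal (suc n) k ⟩
      N + suc n C suc k                    ∎)

  -- By contradiction: the assumption that `F` beats the lexicographic family is what supplies
  -- enough meeting pairs for the cover, and the cover then shows that `F` does not beat it.
  no-full-star : ∀ {F W} (U↭ : U ↭ F ++ W) x → let open Degrees F in
    length F + (n ∸ r) C suc k ≤ suc (suc n) C suc k → suc (suc n) C suc k < length F + (suc n ∸ r) C suc k →
    (∀ y → deg y ≤ deg x) → All (λ A → avoid F A + deg x ≤ length F) F →
    disj (L (suc (suc n)) (suc k) (length F)) ≤ disj F
  no-full-star {F} {W} U↭ x h s> max uncrowded =
    ≮⇒≥ λ F<L → <⇒≱ F<L (optimal F<L)
    where
    open Degrees F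
    open Sizes {n} {k} {r} large s>
    M = L (suc (suc n)) (suc k) s

    0<s : 0 < s
    0<s = +-cancelʳ-< (suc (suc n) C suc k) 0 s
      (<-≤-trans s> (+-monoʳ-≤ s (C-monoˡ (suc k) (≤-trans (m∸n≤m (suc n) r) (n≤1+n (suc n))))))

    module _ (F<L : disj F < disj M) where

      D-F≤ : D F F ≤ D M M
      D-F≤ = begin
        D F F       ≡⟨ sym (2disj≡D F (λ A∈ → subst (0 <_) (sym (∈ˡ-card {k = suc k} F W U↭ A∈)) (s≤s z≤n))) ⟩
        2 * disj F  ≤⟨ *-monoʳ-≤ 2 (<⇒≤ F<L) ⟩
        2 * disj M  ≡⟨ 2disj-L (suc (suc n)) k s ⟩
        D M M       ∎
        where open ≤-Reasoning

      meet-M≤ : ∑meet M ≤ ∑meet F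
      meet-M≤ = +-cancelʳ-≤ (D F F) _ _ (begin
        ∑meet M + D F F      ≤⟨ +-monoʳ-≤ (∑meet M) D-F≤ ⟩
        ∑meet M + D M M      ≡⟨ ∑meet+D M ⟩
        length M * length M  ≡⟨ cong (λ m → m * m) (length-L (suc (suc n)) (suc k) (≤-trans (m≤m+n s _) h)) ⟩
        s * s                ≡⟨ sym (∑meet+D F) ⟩
        ∑meet F + D F F      ∎)
        where open ≤-Reasoning

      deg≤N : deg x ≤ N
      deg≤N = ≤-trans (m≤m+n (deg x) (∑ W (mem x)))
        (≤-reflexive (trans (sym (∑-split {k = suc k} F W U↭ (mem x))) (count-star (suc n) k x)))

      deg≤meet : ∀ {A} → A ∈ F → deg x ≤ meet A
      deg≤meet {A} A∈ = +-cancelʳ-≤ (avoid F A) _ _ (≤-trans (≤-reflexive (+-comm (deg x) _))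
        (≤-trans (All.lookup uncrowded A∈) (≤-reflexive (sym (meet+avoid F A)))))

      open SmallCover F {deg x} {suc (suc r)} {suc k} {pairs n k}
        (∈ˡ-card {k = suc k} F W U↭) (codeg≤pairs {k = k} {F} {W} U↭) 0<s (s≤s z≤n) (s≤s z≤n) codegree-bound max deg≤meet
        (≤-trans (*-monoʳ-≤ (suc (suc r)) deg≤N) RN≤2s)
        (≤-trans (square≤∑meet-L (suc (suc r)) (suc (suc n)) k s h) (*-monoʳ-≤ (suc (suc r)) meet-M≤))

      -- The comparison needs exactly ℓ points. A cover with fewer would leave too many k-sets
      -- missing, since s exceeds what ℓ - 1 points can cover.
      ∣X∣≡R : ∣ X ∣ ≡ suc (suc r)
      ∣X∣≡R = ≤-antisym ∣X∣≤r (≰⇒> λ ∣X∣≤ → <⇒≱ s> (≤-trans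
        (+-monoʳ-≤ s (C-monoˡ (suc k) (∸-monoʳ-≤ (suc (suc n)) ∣X∣≤)))
        (covered-length {k = suc k} F W U↭ X covers)))

      optimal : disj M ≤ disj F
      optimal = covered-disj {suc r} {k = k} {F} {W} U↭ {X} covers ∣X∣≡R (<⇒≤ s>)

  -- An exchange preserves s, so both size premises survive it, and it lowers the number of disjoint
  -- pairs, so the recursion ends. The point of largest degree is chosen afresh for each family.
  by-swaps : ∀ F → Acc _<_ (disj F) → Unique F → (∀ {A} → A ∈ F → ∣ A ∣ ≡ suc k) →
    length F + (n ∸ r) C suc k ≤ suc (suc n) C suc k → suc (suc n) C suc k < length F + (suc n ∸ r) C suc k →
    disj (L (suc (suc n)) (suc k) (length F)) ≤ disj F
  by-swaps F (acc smaller) u card h s> = 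
    from-max (max-value (suc n) deg) (complement u (λ A∈ → ∈-kSubsets⁺ (suc k) _ (card A∈)))
    where
    open Degrees F

    module _ (x : Fin (suc (suc n))) (max : ∀ y → deg y ≤ deg x) where

      swapped : ∀ {W} → U ↭ F ++ W → ∀ {B} → B ∈ W → 0 < mem x B →
        ∀ {A} → A ∈ F → s < avoid F A + deg x → disj (L (suc (suc n)) (suc k) s) ≤ disj F
      swapped {W} U↭ {B} B∈W x∈B {A} A∈F crowded = via (∈⇒↭∷ A∈F)
        where
        B∉F : B ∉ F
        B∉F = ++-apart (Unique-resp-↭ U↭ (kSubsets-unique (suc (suc n)) (suc k))) B∈W
        via : (∃ λ F₀ → F ↭ A ∷ F₀) → disj (L (suc (suc n)) (suc k) s) ≤ disj F
        via (F₀ , F↭) = begin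
          disj (L (suc (suc n)) (suc k) s)   ≡⟨ cong (λ m → disj (L (suc (suc n)) (suc k) m)) same-length ⟩
          disj (L (suc (suc n)) (suc k) (length (B ∷ F₀)))
            ≤⟨ by-swaps (B ∷ F₀) (smaller fewer) unique′ card′
                 (subst (λ m → m + (n ∸ r) C suc k ≤ suc (suc n) C suc k) same-length h)
                 (subst (λ m → suc (suc n) C suc k < m + (suc n ∸ r) C suc k) same-length s>) ⟩
          disj (B ∷ F₀)                      ≤⟨ <⇒≤ fewer ⟩
          disj F                             ∎
          where
          open ≤-Reasoning
          same-length : s ≡ length (B ∷ F₀)
          same-length = ↭-length F↭
          F₀⊆F : ∀ {E} → E ∈ F₀ → E ∈ F
          F₀⊆F E∈ = ∈-resp-↭ (↭-sym F↭) (there E∈)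
          fewer : disj (B ∷ F₀) < disj F
          fewer = swap-disj {A = A} {B} {x} F↭ (λ E∈ → subst (0 <_) (sym (card E∈)) (s≤s z≤n))
            (≤-antisym (⟦⟧≤1 (lookup B x)) x∈B) crowded
          unique′ : Unique (B ∷ F₀)
          unique′ with _ ∷ u₀ ← Unique-resp-↭ F↭ u =
            All.tabulate (λ { E∈ refl → B∉F (F₀⊆F E∈) }) ∷ u₀
          card′ : ∀ {E} → E ∈ B ∷ F₀ → ∣ E ∣ ≡ suc k
          card′ (here refl) = ∈ʳ-card {k = suc k} F W U↭ B∈W
          card′ (there E∈)  = card (F₀⊆F E∈)

      uncrowded? = λ A → avoid F A + deg x ≤? s

      by-crowd : ∀ {W} → U ↭ F ++ W → (∃ λ B → B ∈ W × 0 < mem x B) →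
        Dec (All (λ A → avoid F A + deg x ≤ s) F) → disj (L (suc (suc n)) (suc k) s) ≤ disj F
      by-crowd U↭ _ (yes uncrowded) =
        no-full-star U↭ x h s> max uncrowded
      by-crowd U↭ (B , B∈W , x∈B) (no ¬uncrowded)
        with A , A∈F , crowded ← find (¬All⇒Any¬ uncrowded? F ¬uncrowded) =
        swapped U↭ B∈W x∈B A∈F (≰⇒> crowded)

      by-star : ∀ {W} → U ↭ F ++ W → Dec (∑ W (mem x) ≡ 0) → disj (L (suc (suc n)) (suc k) s) ≤ disj F
      by-star     U↭ (yes star)  = full-star U↭ star u h
      by-star {W} U↭ (no  ¬star) = by-crowd U↭ (∑-pos W (mem x) (n≢0⇒n>0 ¬star)) (All.all? uncrowded? F)

    from-max : (∃ λ x → ∀ y → deg y ≤ deg x) → (∃ λ W → U ↭ F ++ W) → disj (L (suc (suc n)) (suc k) s) ≤ disj F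
    from-max (x , max) (W , U↭) = by-star x max U↭ (∑ W (mem x) ≟ 0)

initial-star : ∀ {k n} (F : List (Subset n)) → length F + (n ∸ 1) C suc k ≤ n C suc k →
  disj (L n (suc k) (length F)) ≡ 0
initial-star {k} {zero}  []      _ = refl
initial-star {k} {zero}  (_ ∷ _) ()
initial-star {k} {suc n} F       h =
  disj-L-star n k (+-cancelʳ-≤ (n C suc k) _ _ (≤-trans h (≤-reflexive (pascal n k))))

-- Deleting a centre lowers n and ℓ by one each. The bound on n falls by at least one along with ℓ,
-- so the hypothesis persists.
large-pred : ∀ {k ℓ n} → 108 * (suc k * suc k) * suc ℓ * (suc k + suc ℓ) < suc n →
  108 * (suc k * suc k) * ℓ * (suc k + ℓ) < n
large-pred {k} {ℓ} {n} large = ≤-pred (≤-trans (s≤s (begin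
  suc (c * ℓ * (suc k + ℓ))              ≤⟨ s≤s (*-monoʳ-≤ (c * ℓ) (+-monoʳ-≤ (suc k) (n≤1+n ℓ))) ⟩
  1 + c * ℓ * (suc k + suc ℓ)            ≤⟨ +-monoˡ-≤ _ (≤-trans (m≤n*m 1 c) (m≤m*n (c * 1) (suc k + suc ℓ))) ⟩
  c * 1 * (suc k + suc ℓ) + c * ℓ * (suc k + suc ℓ)  ≡⟨ lemma c (suc k + suc ℓ) ℓ ⟩
  c * suc ℓ * (suc k + suc ℓ)            ∎)) large)
  where
  open ≤-Reasoning
  c = 108 * (suc k * suc k)
  lemma : ∀ c t ℓ → c * 1 * t + c * ℓ * t ≡ c * suc ℓ * t
  lemma = solve-∀

-- Every recursive call lowers ℓ: on the same ground set if s already satisfies the bound for ℓ - 1,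
-- and on one point fewer as the hypothesis of `Step`. For ℓ = 0 the family is empty; in the top
-- range for ℓ = 1 the lexicographic family lies in a single star.
minimal : ∀ k ℓ n → 108 * (suc k * suc k) * ℓ * (suc k + ℓ) < n → Minimal k ℓ n
minimal-last : ∀ k ℓ n → 108 * (suc k * suc k) * suc ℓ * (suc k + suc ℓ) < n → ∀ (F : List (Subset n)) →
  Unique F → (∀ {A} → A ∈ F → ∣ A ∣ ≡ suc k) → length F + (n ∸ suc ℓ) C suc k ≤ n C suc k →
  n C suc k < length F + (n ∸ ℓ) C suc k → disj (L n (suc k) (length F)) ≤ disj F

minimal k zero    n large []      u card h = z≤n
minimal k zero    n large (A ∷ F) u card h = contradiction h (<⇒≱ (s≤s (m≤n+m (n C suc k) (length F))))
minimal k (suc ℓ) zero    ()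
minimal k (suc ℓ) (suc n) large F u card h = by-size (length F + (suc n ∸ ℓ) C suc k ≤? suc n C suc k)
  where
  by-size : Dec (length F + (suc n ∸ ℓ) C suc k ≤ suc n C suc k) → disj (L (suc n) (suc k) (length F)) ≤ disj F
  by-size (yes h′) = minimal k ℓ (suc n) (m<n⇒m<1+n (large-pred {k} {ℓ} large)) F u card h′
  by-size (no ¬h′) = minimal-last k ℓ (suc n) large F u card h (≰⇒> ¬h′)

minimal-last k zero    n             large F u card h s> = ≤-trans (≤-reflexive (initial-star F h)) z≤n
minimal-last k (suc ℓ) (suc (suc n)) large F u card h s> =
  Step.by-swaps large (minimal k (suc ℓ) (suc n) (large-pred {k} {suc ℓ} large)) F (<-wellFounded (disj F)) u card h s>
minimal-last k (suc ℓ) (suc zero)    large F u card h s> = contradiction large (≤⇒≯ (s≤s z≤n))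

theorem1p6 : (k ℓ n : ℕ) → 1 ≤ k → 1 ≤ ℓ → 108 * (k * k) * ℓ * (k + ℓ) < n →
    (s : ℕ) → s ≤ (n C k) ∸ ((n ∸ ℓ) C k) →
    (F : List (Subset n)) → Unique F → All (λ A → ∣ A ∣ ≡ k) F → length F ≡ s →
    disj (L n k s) ≤ disj F
theorem1p6 (suc k) ℓ n _ _ large s s≤ F unique uniform refl =
  minimal k ℓ n large F unique (All.lookup uniform)
    (m≤o∸n⇒m+n≤o s (C-monoˡ (suc k) (m∸n≤m n ℓ)) s≤)
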